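{- The generating function $$G_{(132,321)}(x,p,q,y,z)=\sum_{n\ge 0}\ \sum_{\pi\in S_n(132,321)} x^n p^{\operatorname{asc}(\pi)} q^{\operatorname{des}(\pi)} y^{\operatorname{MNA}(\pi)} z^{\operatorname{MND}(\pi)}$$ is equal to $\dfrac{A}{(1-p^2x^2y)^3}$, where $$A=1 + x + p x^2 y - 3 p^2 x^2 y - 2 p^2 x^3 y - 2 p^3 x^4 y^2 + 3 p^4 x^4 y^2 + p^4 x^5 y^2 + p^5 x^6 y^3 - p^6 x^6 y^3 + q x^2 z + 3 p q x^3 y z + p^2 q x^4 y z + 2 p^2 q x^4 y^2 z + p^3 q x^5 y^2 z.$$
   Context: For $n\ge 0$, $S_n$ denotes the set of permutations $\pi=\pi_1\pi_2\cdots\pi_n$ of $[n]=\{1,\dots,n\}$ ($S_0$ consists of the empty permutation, for which all statistics below are $0$). A permutation $\pi\in S_n$ avoids a pattern $\tau\in S_k$ if there are no indices $i_1<\dots<i_k$ such that $\pi_{i_a}<\pi_{i_b}$ if and only if $\tau_a<\tau_b$; $S_n(\tau,\rho)$ is the set of permutations in $S_n$ avoiding both $\tau$ and $\rho$. $\operatorname{asc}(\pi)$ (resp. $\operatorname{des}(\pi)$) is the number of $i\in[n-1]$ with $\pi_i<\pi_{i+1}$ (resp. $\pi_i>\pi_{i+1}$). $\operatorname{MNA}(\pi)$ is the maximum size of a set $I\subseteq[n-1]$ such that $\pi_i<\pi_{i+1}$ for all $i\in I$ and $|i-j|\ge 2$ for distinct $i,j\in I$; $\operatorname{MND}(\pi)$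 is defined analogously with $\pi_i>\pi_{i+1}$. -}

module Defs where

open import Level using (0ℓ)
open import Algebra.Bundles.Raw using (RawRing)
import Algebra.Definitions.RawSemiring as RawSemiringDefinitions
open import Data.Bool.Base using (Bool; true; false)
open import Data.Fin.Base as Fin using (Fin; zero; suc; toℕ; inject₁; _<_)
open import Data.Fin.Properties as Fin using (_<?_; all?; any?)
open import Data.Fin.Subset using (Subset; _∈_; ∣_∣)
open import Data.Fin.Subset.Properties using (_∈?_)
import Data.Integer.Base as ℤ
open import Data.List.Base as List using (List; []; _∷_; [_]; cartesianProductWith; filter)
open import Data.List.Extrema.Nat using (max)
open import Data.Nat.Base as ℕ using (ℕ; zero; suc; pred; _∸_; ∣_-_∣)
import Data.Nat.Properties as ℕ
open import Data.Product using (∃; _×_; _,_)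
open import Data.Vec.Base as Vec using (Vec; []; _∷_; lookup)
open import Data.Vec.Relation.Unary.AllPairs using (allPairs?)
open import Data.Vec.Relation.Unary.Unique.Propositional using (Unique)
open import Function.Bundles using (_⇔_; mk⇔; module Equivalence)
open import Relation.Binary.PropositionalEquality using (_≢_)
open import Relation.Nullary using (¬_; Dec)
open import Relation.Nullary.Decidable using (map′; ¬?; _×-dec_; _→-dec_)
open import Relation.Unary using (Pred; Decidable)

allVecs : {A : Set} → List A → (n : ℕ) → List (Vec A n)
allVecs xs zero    = [ [] ]
allVecs xs (suc n) = cartesianProductWith _∷_ xs (allVecs xs n)

_⇔-dec_ : {A B : Set} → Dec A → Dec B → Dec (A ⇔ B)
a? ⇔-dec b? = map′ (λ (f , g) → mk⇔ f g) (λ e → Equivalence.to e , Equivalence.from e)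
                   ((a? →-dec b?) ×-dec (b? →-dec a?))

anyVec? : ∀ {n} k {P : Pred (Vec (Fin n) k) 0ℓ} → Decidable P → Dec (∃ P)
anyVec? zero    P? = map′ ([] ,_) (λ { ([] , p) → p }) (P? [])
anyVec? (suc k) P? =
  map′ (λ (i , is , p) → i ∷ is , p) (λ { (i ∷ is , p) → i , is , p })
       (any? λ i → anyVec? k λ is → P? (i ∷ is))

-- Permutations are in one-line notation, with both positions and values
-- numbered from 0.  A word of n distinct letters of Fin n is a permutation.

Word : ℕ → Set
Word n = Vec (Fin n) n

unique? : ∀ {m n} → Decidable (Unique {A = Fin m} {n})
unique? = allPairs? λ i j → ¬? (i Fin.≟ j)

permutations : (n : ℕ) → List (Word n)
permutations n = filter unique? (allVecs (List.allFin n) n)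

module _ {n k : ℕ} (π : Word n) (τ : Word k) where

  Occurrence : Vec (Fin n) k → Set
  Occurrence is =
    (∀ a b → a < b → lookup is a < lookup is b) ×
    (∀ a b → lookup π (lookup is a) < lookup π (lookup is b) ⇔ lookup τ a < lookup τ b)

  occurrence? : Decidable Occurrence
  occurrence? is =
    (all? λ a → all? λ b → (a <? b) →-dec (lookup is a <? lookup is b)) ×-dec
    (all? λ a → all? λ b →
      (lookup π (lookup is a) <? lookup π (lookup is b)) ⇔-dec (lookup τ a <? lookup τ b))

  Avoids : Set
  Avoids = ¬ ∃ Occurrence

  avoids? : Dec Avoids
  avoids? = ¬? (anyVec? k occurrence?)

S : ∀ n {k l} → Word k → Word l → List (Word n)
S n τ ρ = filter (λ π → avoids? π τ ×-dec avoids? π ρ) (permutations n)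

-- Adjacent positions (i, i+1) of a word of length n are indexed by i : Fin (n - 1).

Ascent Descent : ∀ {m n} → Vec (Fin m) n → Pred (Fin (pred n)) 0ℓ
Ascent  (x ∷ xs) i = lookup (x ∷ xs) (inject₁ i) < lookup xs i
Descent (x ∷ xs) i = lookup xs i < lookup (x ∷ xs) (inject₁ i)

ascent? : ∀ {m n} (π : Vec (Fin m) n) → Decidable (Ascent π)
ascent? (x ∷ xs) i = lookup (x ∷ xs) (inject₁ i) <? lookup xs i

descent? : ∀ {m n} (π : Vec (Fin m) n) → Decidable (Descent π)
descent? (x ∷ xs) i = lookup xs i <? lookup (x ∷ xs) (inject₁ i)

module _ {m : ℕ} {P : Pred (Fin m) 0ℓ} (P? : Decidable P) where

  number : ℕ
  number = Vec.count P? (Vec.allFin m)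

  NonOverlapping : Pred (Subset m) 0ℓ
  NonOverlapping I =
    (∀ i → i ∈ I → P i) ×
    (∀ i j → i ∈ I → j ∈ I → i ≢ j → 2 ℕ.≤ ∣ toℕ i - toℕ j ∣)

  nonOverlapping? : Decidable NonOverlapping
  nonOverlapping? I =
    (all? λ i → (i ∈? I) →-dec P? i) ×-dec
    (all? λ i → all? λ j →
      (i ∈? I) →-dec ((j ∈? I) →-dec (¬? (i Fin.≟ j) →-dec (2 ℕ.≤? ∣ toℕ i - toℕ j ∣))))

  -- The empty set qualifies, so the default value 0 does not affect the maximum.
  maxNonOverlapping : ℕ
  maxNonOverlapping =
    max 0 (List.map ∣_∣ (filter nonOverlapping? (allVecs (true ∷ false ∷ []) m)))

asc des MNA MND : ∀ {n} → Word n → ℕ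
asc π = number (ascent? π)
des π = number (descent? π)
MNA π = maxNonOverlapping (ascent? π)
MND π = maxNonOverlapping (descent? π)

-- A series is its sequence of coefficients.
PowerSeries : RawRing 0ℓ 0ℓ → RawRing 0ℓ 0ℓ
PowerSeries R = record
  { Carrier = ℕ → R.Carrier
  ; _≈_     = λ f g → ∀ n → f n R.≈ g n
  ; _+_     = λ f g n → f n R.+ g n
  ; _*_     = λ f g n → sum {suc n} λ i → f (toℕ i) R.* g (n ∸ toℕ i)
  ; -_      = λ f n → R.- f n
  ; 0#      = λ _ → R.0#
  ; 1#      = one
  }
  where
  module R = RawRing R
  open RawSemiringDefinitions R.rawSemiring using (sum)

  one : ℕ → R.Carrier
  one zero    = R.1#
  one (suc _) = R.0#

module _ (R : RawRing 0ℓ 0ℓ) where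
  open RawRing R

  const : Carrier → RawRing.Carrier (PowerSeries R)
  const a zero    = a
  const a (suc _) = 0#

  var : RawRing.Carrier (PowerSeries R)
  var (suc zero) = 1#
  var _          = 0#

ℤ⟦p⟧ ℤ⟦p,q⟧ ℤ⟦p,q,y⟧ ℤ⟦p,q,y,z⟧ ℤ⟦p,q,y,z,x⟧ : RawRing 0ℓ 0ℓ
ℤ⟦p⟧         = PowerSeries ℤ.+-*-rawRing
ℤ⟦p,q⟧       = PowerSeries ℤ⟦p⟧
ℤ⟦p,q,y⟧     = PowerSeries ℤ⟦p,q⟧
ℤ⟦p,q,y,z⟧   = PowerSeries ℤ⟦p,q,y⟧
ℤ⟦p,q,y,z,x⟧ = PowerSeries ℤ⟦p,q,y,z⟧

module Coefficients where
  open RawRing ℤ⟦p,q,y,z⟧ public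
  open RawSemiringDefinitions rawSemiring public using (_^_)

  p q y z : Carrier
  p = const ℤ⟦p,q,y⟧ (const ℤ⟦p,q⟧ (const ℤ⟦p⟧ (var ℤ.+-*-rawRing)))
  q = const ℤ⟦p,q,y⟧ (const ℤ⟦p,q⟧ (var ℤ⟦p⟧))
  y = const ℤ⟦p,q,y⟧ (var ℤ⟦p,q⟧)
  z = var ℤ⟦p,q,y⟧

  weight : ∀ {n} → Word n → Carrier
  weight π = p ^ asc π * q ^ des π * y ^ MNA π * z ^ MND π

-- The n-th coefficient is the coefficient of xⁿ, an element of ℤ⟦p,q,y,z⟧.
G : ∀ {k l} → Word k → Word l → RawRing.Carrier ℤ⟦p,q,y,z,x⟧
G τ ρ n = List.foldr _+_ 0# (List.map weight (S n τ ρ))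
  where open Coefficients

[132] [321] : Word 3
[132] = zero ∷ suc (suc zero) ∷ suc zero ∷ []
[321] = suc (suc zero) ∷ suc zero ∷ zero ∷ []

module Series where
  open RawRing ℤ⟦p,q,y,z,x⟧ public
  open RawSemiringDefinitions rawSemiring public using (_^_) renaming (_×_ to _·_)

  infixl 6 _-_
  _-_ : Carrier → Carrier → Carrier
  a - b = a + (- b)

  x p q y z : Carrier
  x = var ℤ⟦p,q,y,z⟧
  p = const ℤ⟦p,q,y,z⟧ Coefficients.p
  q = const ℤ⟦p,q,y,z⟧ Coefficients.q
  y = const ℤ⟦p,q,y,z⟧ Coefficients.y
  z = const ℤ⟦p,q,y,z⟧ Coefficients.z

  A : Carrier
  A = 1# + x + p * x ^ 2 * y - 3 · p ^ 2 * x ^ 2 * y - 2 · p ^ 2 * x ^ 3 * y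
    - 2 · p ^ 3 * x ^ 4 * y ^ 2 + 3 · p ^ 4 * x ^ 4 * y ^ 2 + p ^ 4 * x ^ 5 * y ^ 2
    + p ^ 5 * x ^ 6 * y ^ 3 - p ^ 6 * x ^ 6 * y ^ 3
    + q * x ^ 2 * z + 3 · p * q * x ^ 3 * y * z + p ^ 2 * q * x ^ 4 * y * z
    + 2 · p ^ 2 * q * x ^ 4 * y ^ 2 * z + p ^ 3 * q * x ^ 5 * y ^ 2 * z

{-# OPTIONS --safe #-}

-- A permutation avoiding 132 and 321 is either the identity or obtained from
-- 1 2 … n by exchanging an initial block of length a with the adjacent block of
-- length b.  The latter consists of two ascending runs, of lengths a and
-- d = n - a, and b ranges over 1, …, d.  With u(x) = Σ_{n≥1} pⁿ⁻¹ y^⌊n/2⌋ xⁿ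
-- counting ascending runs and v(x) = Σ n uₙ xⁿ, this gives G = 1 + u + q z u v.
-- For t = p²x²y one has u = (x + p x² y) + t u and
-- v = (2 t u + x + 2 p x² y) + t v, so that (1 - t)³ G is the polynomial A.
module Submission where

open import Defs
open import Algebra.Definitions using (Invertible)
open import Data.Product using (Σ; _,_)

open import Algebra.Bundles using (CommutativeRing)
open import Algebra.Bundles.Raw using (RawRing)
open import Algebra.Consequences.Setoid using (comm∧idˡ⇒id; comm∧distrʳ⇒distr)
import Algebra.Construct.Pointwise as Pointwise
import Algebra.Definitions.RawSemiring as RawSemiringDefinitions
import Algebra.Properties.Ring as RingProperties
import Algebra.Solver.Ring.NaturalCoefficients.Default as Solver
open import Algebra.Structures using (IsCommutativeRing)
open import Data.Fin.Base as Fin using (Fin; zero; suc; toℕ)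
open import Data.Fin.Properties using (toℕ<n)
open import Data.Integer.Properties using (+-*-commutativeRing)
open import Data.List.Base as List using (List; []; _∷_; _++_; concat)
open import Data.List.Relation.Binary.Permutation.Propositional as ↭ using (_↭_)
open import Data.Nat.Base as ℕ using (ℕ; zero; suc; _∸_; _≤_; z≤n; s≤s⁻¹; ⌊_/2⌋)
open import Data.Nat.Properties using (m+[n∸m]≡n)
open import Function.Base using (_∘_)
open import Level using (0ℓ)
open import Relation.Binary.PropositionalEquality as ≡ using (_≡_)
import Relation.Binary.Reasoning.Setoid as ≈-Reasoning

-- For fixed a the statistics do not see b, only the place of the single descent. Hence the d words
-- sharing a weigh the same, and together they multiply the weight of the second run by its length
-- d; this is where v comes from. The weight itself factors over the two runs, because the descent
-- keeps the ascents of one run from being adjacent to those of the other.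
--
-- The exponent 3 arises because u has a simple and v a double pole at t = 1: with w = x + p x² y
-- and r = x + 2 p x² y, u = w / (1 - t) and v = (2 t w + (1 - t) r) / (1 - t)². Division is
-- replaced by multiplication with an explicit inverse of 1 - t, the series with coefficient (p²
-- y)^k at x^(2k).
--
-- The algebra and the summation of weights are carried out over an arbitrary commutative ring with
-- four chosen elements; the nested series over the integers enter only at the very end.

-- Ring laws of the Cauchy product.

module CauchyProduct (R : CommutativeRing 0ℓ 0ℓ) where
  private module R = CommutativeRing R
  open R using (_≈_; _+_; _*_; 0#; refl; trans; +-cong; +-congˡ; +-congʳ; *-cong)
  open RawRing (PowerSeries R.rawRing) using (Carrier)
    renaming (_≈_ to _≋_; _*_ to _⊛_; _+_ to _⊕_; -_ to ⊝_; 0# to 𝟎; 1# to 𝟏)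
  open ≈-Reasoning R.setoid
  open Solver R.commutativeSemiring using (solve; con; _:+_; _:*_; _:=_)

  -- By computation, `(f ⊛ g) (suc n)` is `f 0 * g (suc n) + (tail f ⊛ g) n`. The ring laws below
  -- rest on this recursion, which replaces any manipulation of finite sums.
  tail : Carrier → Carrier
  tail f n = f (suc n)

  infixr 7 _◂_
  _◂_ : R.Carrier → Carrier → Carrier
  (a ◂ f) n = a * f n

  ⊛-cong : ∀ {f f′ g g′} → f ≋ f′ → g ≋ g′ → (f ⊛ g) ≋ (f′ ⊛ g′)
  ⊛-cong f≋ g≋ zero    = +-congʳ (*-cong (f≋ 0) (g≋ 0))
  ⊛-cong f≋ g≋ (suc n) = +-cong (*-cong (f≋ 0) (g≋ (suc n))) (⊛-cong (λ k → f≋ (suc k)) g≋ n)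

  ⊛-distribʳ-⊕ : ∀ h f g → ((f ⊕ g) ⊛ h) ≋ ((f ⊛ h) ⊕ (g ⊛ h))
  ⊛-distribʳ-⊕ h f g zero =
    solve 3 (λ f g h → (f :+ g) :* h :+ con 0 := (f :* h :+ con 0) :+ (g :* h :+ con 0))
      refl (f 0) (g 0) (h 0)
  ⊛-distribʳ-⊕ h f g (suc n) = begin
    (f 0 + g 0) * h (suc n) + ((tail f ⊕ tail g) ⊛ h) n
      ≈⟨ +-congˡ (⊛-distribʳ-⊕ h (tail f) (tail g) n) ⟩
    (f 0 + g 0) * h (suc n) + ((tail f ⊛ h) n + (tail g ⊛ h) n)
      ≈⟨ solve 5 (λ f g h a b → (f :+ g) :* h :+ (a :+ b) := (f :* h :+ a) :+ (g :* h :+ b))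
           refl (f 0) (g 0) (h (suc n)) ((tail f ⊛ h) n) ((tail g ⊛ h) n) ⟩
    (f 0 * h (suc n) + (tail f ⊛ h) n) + (g 0 * h (suc n) + (tail g ⊛ h) n) ∎

  ◂-⊛ : ∀ a f g → ((a ◂ f) ⊛ g) ≋ (a ◂ (f ⊛ g))
  ◂-⊛ a f g zero =
    solve 3 (λ a f g → (a :* f) :* g :+ con 0 := a :* (f :* g :+ con 0)) refl a (f 0) (g 0)
  ◂-⊛ a f g (suc n) = begin
    (a * f 0) * g (suc n) + ((a ◂ tail f) ⊛ g) n
      ≈⟨ +-congˡ (◂-⊛ a (tail f) g n) ⟩
    (a * f 0) * g (suc n) + a * (tail f ⊛ g) n
      ≈⟨ solve 4 (λ a f g h → (a :* f) :* g :+ a :* h := a :* (f :* g :+ h))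
           refl a (f 0) (g (suc n)) ((tail f ⊛ g) n) ⟩
    a * (f 0 * g (suc n) + (tail f ⊛ g) n) ∎

  -- The series `tail (f ⊛ g)` is, by computation, the sum of `f 0 ◂ tail g` and `tail f ⊛ g`;
  -- distributivity and `◂-⊛` then leave the same claim for `tail f`.
  ⊛-assoc : ∀ f g h → ((f ⊛ g) ⊛ h) ≋ (f ⊛ (g ⊛ h))
  ⊛-assoc f g h zero =
    solve 3 (λ f g h → (f :* g :+ con 0) :* h :+ con 0 := f :* (g :* h :+ con 0) :+ con 0)
      refl (f 0) (g 0) (h 0)
  ⊛-assoc f g h (suc n) = begin
    (f 0 * g 0 + 0#) * h (suc n) + (((f 0 ◂ tail g) ⊕ (tail f ⊛ g)) ⊛ h) n
      ≈⟨ +-congˡ (⊛-distribʳ-⊕ h (f 0 ◂ tail g) (tail f ⊛ g) n) ⟩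
    (f 0 * g 0 + 0#) * h (suc n) + (((f 0 ◂ tail g) ⊛ h) n + ((tail f ⊛ g) ⊛ h) n)
      ≈⟨ +-congˡ (+-cong (◂-⊛ (f 0) (tail g) h n) (⊛-assoc (tail f) g h n)) ⟩
    (f 0 * g 0 + 0#) * h (suc n) + (f 0 * (tail g ⊛ h) n + (tail f ⊛ (g ⊛ h)) n)
      ≈⟨ solve 5 (λ f g h a b → (f :* g :+ con 0) :* h :+ (f :* a :+ b) := f :* (g :* h :+ a) :+ b)
           refl (f 0) (g 0) (h (suc n)) ((tail g ⊛ h) n) ((tail f ⊛ (g ⊛ h)) n) ⟩
    f 0 * (g 0 * h (suc n) + (tail g ⊛ h) n) + (tail f ⊛ (g ⊛ h)) n ∎

  -- The mirror image of the defining recursion, which takes apart the left factor only. Comparing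
  -- the two recursions gives commutativity.
  ⊛-tailʳ : ∀ f g n → (f ⊛ g) (suc n) ≈ f (suc n) * g 0 + (f ⊛ tail g) n
  ⊛-tailʳ f g zero =
    solve 4 (λ f g f′ g′ → f :* g′ :+ (f′ :* g :+ con 0) := f′ :* g :+ (f :* g′ :+ con 0))
      refl (f 0) (g 0) (f 1) (g 1)
  ⊛-tailʳ f g (suc n) = begin
    f 0 * g (suc (suc n)) + (tail f ⊛ g) (suc n)
      ≈⟨ +-congˡ (⊛-tailʳ (tail f) g n) ⟩
    f 0 * g (suc (suc n)) + (f (suc (suc n)) * g 0 + (tail f ⊛ tail g) n)
      ≈⟨ solve 3 (λ a b c → a :+ (b :+ c) := b :+ (a :+ c)) refl
           (f 0 * g (suc (suc n))) (f (suc (suc n)) * g 0) ((tail f ⊛ tail g) n) ⟩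
    f (suc (suc n)) * g 0 + (f 0 * g (suc (suc n)) + (tail f ⊛ tail g) n) ∎

  ⊛-comm : ∀ f g → (f ⊛ g) ≋ (g ⊛ f)
  ⊛-comm f g zero    = +-congʳ (R.*-comm (f 0) (g 0))
  ⊛-comm f g (suc n) = begin
    (f ⊛ g) (suc n)                  ≈⟨ ⊛-tailʳ f g n ⟩
    f (suc n) * g 0 + (f ⊛ tail g) n ≈⟨ +-cong (R.*-comm _ _) (⊛-comm f (tail g) n) ⟩
    g 0 * f (suc n) + (tail g ⊛ f) n ∎

  ⊛-zeroˡ : ∀ f → (𝟎 ⊛ f) ≋ 𝟎
  ⊛-zeroˡ f zero    = trans (R.+-identityʳ _) (R.zeroˡ (f 0))
  ⊛-zeroˡ f (suc n) = trans (+-cong (R.zeroˡ (f (suc n))) (⊛-zeroˡ f n)) (R.+-identityʳ 0#)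

  const-⊛ : ∀ a f → (const R.rawRing a ⊛ f) ≋ (a ◂ f)
  const-⊛ a f zero    = R.+-identityʳ _
  const-⊛ a f (suc n) = trans (+-congˡ (⊛-zeroˡ f n)) (R.+-identityʳ _)

  ⊛-identityˡ : ∀ f → (𝟏 ⊛ f) ≋ f
  ⊛-identityˡ f zero    = trans (R.+-identityʳ _) (R.*-identityˡ (f 0))
  ⊛-identityˡ f (suc n) = begin
    R.1# * f (suc n) + (𝟎 ⊛ f) n ≈⟨ +-cong (R.*-identityˡ _) (⊛-zeroˡ f n) ⟩
    f (suc n) + 0#               ≈⟨ R.+-identityʳ _ ⟩
    f (suc n)                    ∎

  var-⊛-zero : ∀ f → (var R.rawRing ⊛ f) 0 ≈ 0#
  var-⊛-zero f = trans (R.+-identityʳ _) (R.zeroˡ (f 0))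

  var-⊛-suc : ∀ f n → (var R.rawRing ⊛ f) (suc n) ≈ f n
  var-⊛-suc f n = begin
    0# * f (suc n) + (tail (var R.rawRing) ⊛ f) n
      ≈⟨ +-cong (R.zeroˡ _) (⊛-cong {g = f} tail-var (λ _ → refl) n) ⟩
    0# + (𝟏 ⊛ f) n
      ≈⟨ trans (R.+-identityˡ _) (⊛-identityˡ f n) ⟩
    f n ∎
    where
    tail-var : tail (var R.rawRing) ≋ 𝟏
    tail-var zero    = refl
    tail-var (suc _) = refl

  isCommutativeRing : IsCommutativeRing _≋_ _⊕_ _⊛_ ⊝_ 𝟎 𝟏
  isCommutativeRing = record
    { isRing = record
      { +-isAbelianGroup = +-isAbelianGroup
      ; *-cong           = ⊛-cong
      ; *-assoc          = ⊛-assoc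
      ; *-identity       = comm∧idˡ⇒id setoid ⊛-comm ⊛-identityˡ
      ; distrib          = comm∧distrʳ⇒distr setoid (λ f≋ g≋ n → +-cong (f≋ n) (g≋ n)) ⊛-comm ⊛-distribʳ-⊕
      }
    ; *-comm = ⊛-comm
    }
    where
    open import Algebra.Structures _≋_ using (IsAbelianGroup)
    +-isAbelianGroup : IsAbelianGroup _⊕_ 𝟎 ⊝_
    +-isAbelianGroup = Pointwise.isAbelianGroup ℕ R.+-isAbelianGroup
    open IsAbelianGroup +-isAbelianGroup using (setoid)

powerSeriesRing : CommutativeRing 0ℓ 0ℓ → CommutativeRing 0ℓ 0ℓ
powerSeriesRing R = record { isCommutativeRing = CauchyProduct.isCommutativeRing R }

-- Comparing terms of ℤ⟦p,q,y,z,x⟧ by unfolding five nested Cauchy products is infeasible.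
-- Abstracting the operations into records ensures that only the operations themselves have
-- to be compared, one at a time.
record CoefficientNotation (Carrier : Set) : Set where
  infixl 6 _+_
  infixl 7 _*_
  infixr 8 _^_
  field
    _+_ _*_ : Carrier → Carrier → Carrier
    0#      : Carrier
    _^_     : Carrier → ℕ → Carrier
    p q y z : Carrier

  weight : ∀ {n} → Word n → Carrier
  weight π = p ^ asc π * q ^ des π * y ^ MNA π * z ^ MND π

  total : ∀ {n} → List (Word n) → Carrier
  total πs = List.foldr _+_ 0# (List.map weight πs)

record SeriesNotation (Carrier : Set) : Set₁ where
  infix  4 _≈_
  infixl 6 _+_ _-_
  infixl 7 _*_
  infixr 8 _^_ _·_
  field
    _≈_         : Carrier → Carrier → Set
    _+_ _-_ _*_ : Carrier → Carrier → Carrier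
    1#          : Carrier
    _^_         : Carrier → ℕ → Carrier
    _·_         : ℕ → Carrier → Carrier
    x p q y z   : Carrier

  numerator : Carrier
  numerator =
      1# + x + p * x ^ 2 * y - 3 · p ^ 2 * x ^ 2 * y - 2 · p ^ 2 * x ^ 3 * y
    - 2 · p ^ 3 * x ^ 4 * y ^ 2 + 3 · p ^ 4 * x ^ 4 * y ^ 2 + p ^ 4 * x ^ 5 * y ^ 2
    + p ^ 5 * x ^ 6 * y ^ 3 - p ^ 6 * x ^ 6 * y ^ 3
    + q * x ^ 2 * z + 3 · p * q * x ^ 3 * y * z + p ^ 2 * q * x ^ 4 * y * z
    + 2 · p ^ 2 * q * x ^ 4 * y ^ 2 * z + p ^ 3 * q * x ^ 5 * y ^ 2 * z

  IsRational : Carrier → Carrier → Set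
  IsRational f A =
    Σ (Invertible _≈_ 1# _*_ ((1# - p ^ 2 * x ^ 2 * y) ^ 3))
    (λ (D⁻¹ , _) → f ≈ A * D⁻¹)

-- The numerator as a combination of powers of 1 - t, and the solution of f = g + t f.

module Numerator (L : CommutativeRing 0ℓ 0ℓ) where
  open CommutativeRing L hiding (_-_; zero)
  open RawSemiringDefinitions (RawRing.rawSemiring rawRing) using (_^_) renaming (_×_ to _·_)
  open RingProperties ring using (-1*x≈-x; -‿involutive; +-cancelʳ)
  open import Algebra.Properties.Semiring.Exp semiring using (^-congˡ)
  open import Algebra.Properties.Semiring.Mult semiring using () renaming (×-congʳ to ·-congʳ)
  open ≈-Reasoning setoid
  open Solver commutativeSemiring using (solve; con; Polynomial; _:+_; _:*_; _:=_)

  infixl 6 _-_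
  _-_ : Carrier → Carrier → Carrier
  a - b = a + (- b)

  seriesNotation : (x p q y z : Carrier) → SeriesNotation Carrier
  seriesNotation x p q y z = record
    { _≈_ = _≈_ ; _+_ = _+_ ; _-_ = _-_ ; _*_ = _*_ ; 1# = 1# ; _^_ = _^_ ; _·_ = _·_
    ; x = x ; p = p ; q = q ; y = y ; z = z
    }

  numerator : (x p q y z : Carrier) → Carrier
  numerator x p q y z = SeriesNotation.numerator (seriesNotation x p q y z)

  private
    infixr 9 _:^_ _:·_
    _:^_ : ∀ {n} → Polynomial n → ℕ → Polynomial n
    a :^ zero  = con 1
    a :^ suc n = a :* a :^ n

    _:·_ : ∀ {n} → ℕ → Polynomial n → Polynomial n
    zero  :· a = con 0
    suc n :· a = a :+ n :· a

    -‿as-* : ∀ {a a′} b → a ≈ a′ → a - b ≈ a′ + - 1# * b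
    -‿as-* b a≈a′ = +-cong a≈a′ (sym (-1*x≈-x b))

    -1*-1 : - 1# * - 1# ≈ 1#
    -1*-1 = trans (-1*x≈-x (- 1#)) (-‿involutive 1#)

  -- The signs are a sixth indeterminate e standing for -1, since the solver
  -- only knows natural coefficients.
  numerator-expand : ∀ x p q y z → let t = p ^ 2 * x ^ 2 * y; w = x + p * x ^ 2 * y in
    numerator x p q y z ≈
      (1# - t) ^ 3 + (1# - t) ^ 2 * w + q * z * w * (t * x + (x + 2 · (p * x ^ 2 * y)))
  numerator-expand x p q y z = begin
    numerator x p q y z
      ≈⟨ signs ⟩
    1# + x + p * x ^ 2 * y + e * (3 · p ^ 2 * x ^ 2 * y) + e * (2 · p ^ 2 * x ^ 3 * y)
      + e * (2 · p ^ 3 * x ^ 4 * y ^ 2) + 3 · p ^ 4 * x ^ 4 * y ^ 2 + p ^ 4 * x ^ 5 * y ^ 2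
      + p ^ 5 * x ^ 6 * y ^ 3 + e * (p ^ 6 * x ^ 6 * y ^ 3)
      + q * x ^ 2 * z + 3 · p * q * x ^ 3 * y * z + p ^ 2 * q * x ^ 4 * y * z
      + 2 · p ^ 2 * q * x ^ 4 * y ^ 2 * z + p ^ 3 * q * x ^ 5 * y ^ 2 * z
      -- Both sides are of degree at most one in `e`, so the identity holds with `e` free. That
      -- `e * e` is `1#` enters only through `square` and `cube`.
      ≈⟨ solve 6 (λ x p q y z e → let t = p :^ 2 :* x :^ 2 :* y; w = x :+ p :* x :^ 2 :* y in
           con 1 :+ x :+ p :* x :^ 2 :* y :+ e :* (3 :· p :^ 2 :* x :^ 2 :* y) :+ e :* (2 :· p :^ 2 :* x :^ 3 :* y)
           :+ e :* (2 :· p :^ 3 :* x :^ 4 :* y :^ 2) :+ 3 :· p :^ 4 :* x :^ 4 :* y :^ 2 :+ p :^ 4 :* x :^ 5 :* y :^ 2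
           :+ p :^ 5 :* x :^ 6 :* y :^ 3 :+ e :* (p :^ 6 :* x :^ 6 :* y :^ 3)
           :+ q :* x :^ 2 :* z :+ 3 :· p :* q :* x :^ 3 :* y :* z :+ p :^ 2 :* q :* x :^ 4 :* y :* z
           :+ 2 :· p :^ 2 :* q :* x :^ 4 :* y :^ 2 :* z :+ p :^ 3 :* q :* x :^ 5 :* y :^ 2 :* z
           :=
           (con 1 :+ 3 :· (e :* t) :+ 3 :· t :^ 2 :+ e :* t :^ 3)
           :+ (con 1 :+ 2 :· (e :* t) :+ t :^ 2) :* w
           :+ q :* z :* w :* (t :* x :+ (x :+ 2 :· (p :* x :^ 2 :* y))))
         refl x p q y z e ⟩
    (1# + 3 · (e * t) + 3 · t ^ 2 + e * t ^ 3) + (1# + 2 · (e * t) + t ^ 2) * w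
      + q * z * w * (t * x + (x + 2 · (p * x ^ 2 * y)))
      ≈⟨ +-congʳ (+-cong cube (*-congʳ square)) ⟨
    (1# - t) ^ 3 + (1# - t) ^ 2 * w + q * z * w * (t * x + (x + 2 · (p * x ^ 2 * y))) ∎
    where
    e t w : Carrier
    e = - 1#
    t = p ^ 2 * x ^ 2 * y
    w = x + p * x ^ 2 * y

    1-t : 1# - t ≈ 1# + e * t
    1-t = -‿as-* t refl

    square : (1# - t) ^ 2 ≈ 1# + 2 · (e * t) + t ^ 2
    square = begin
      (1# - t) ^ 2
        ≈⟨ *-cong 1-t (*-congʳ 1-t) ⟩
      (1# + e * t) ^ 2
        ≈⟨ solve 2 (λ e t → (con 1 :+ e :* t) :^ 2 := con 1 :+ 2 :· (e :* t) :+ e :* e :* t :^ 2)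
             refl e t ⟩
      1# + 2 · (e * t) + e * e * t ^ 2
        ≈⟨ +-congˡ (trans (*-congʳ -1*-1) (*-identityˡ _)) ⟩
      1# + 2 · (e * t) + t ^ 2 ∎

    cube : (1# - t) ^ 3 ≈ 1# + 3 · (e * t) + 3 · t ^ 2 + e * t ^ 3
    cube = begin
      (1# - t) ^ 3
        ≈⟨ *-cong 1-t square ⟩
      (1# + e * t) * (1# + 2 · (e * t) + t ^ 2)
        ≈⟨ solve 2 (λ e t → (con 1 :+ e :* t) :* (con 1 :+ 2 :· (e :* t) :+ t :^ 2)
             := con 1 :+ 3 :· (e :* t) :+ (t :^ 2 :+ 2 :· (e :* e :* t :^ 2)) :+ e :* t :^ 3) refl e t ⟩
      1# + 3 · (e * t) + (t ^ 2 + 2 · (e * e * t ^ 2)) + e * t ^ 3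
        ≈⟨ +-congʳ (+-congˡ (+-congˡ (+-cong ee (+-congʳ ee)))) ⟩
      1# + 3 · (e * t) + 3 · t ^ 2 + e * t ^ 3 ∎
      where
      ee : e * e * t ^ 2 ≈ t ^ 2
      ee = trans (*-congʳ -1*-1) (*-identityˡ _)

    signs : numerator x p q y z ≈
      1# + x + p * x ^ 2 * y + e * (3 · p ^ 2 * x ^ 2 * y) + e * (2 · p ^ 2 * x ^ 3 * y)
      + e * (2 · p ^ 3 * x ^ 4 * y ^ 2) + 3 · p ^ 4 * x ^ 4 * y ^ 2 + p ^ 4 * x ^ 5 * y ^ 2
      + p ^ 5 * x ^ 6 * y ^ 3 + e * (p ^ 6 * x ^ 6 * y ^ 3)
      + q * x ^ 2 * z + 3 · p * q * x ^ 3 * y * z + p ^ 2 * q * x ^ 4 * y * z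
      + 2 · p ^ 2 * q * x ^ 4 * y ^ 2 * z + p ^ 3 * q * x ^ 5 * y ^ 2 * z
    signs = +-congʳ (+-congʳ (+-congʳ (+-congʳ (+-congʳ (-‿as-* _ (+-congʳ (+-congʳ (+-congʳ
      (-‿as-* _ (-‿as-* _ (-‿as-* _ refl)))))))))))

  module _ {t : Carrier} where
    private
      d : Carrier
      d = 1# - t

      d+t≈1 : d + t ≈ 1#
      d+t≈1 = begin
        1# + - t + t   ≈⟨ +-assoc 1# (- t) t ⟩
        1# + (- t + t) ≈⟨ +-congˡ (-‿inverseˡ t) ⟩
        1# + 0#        ≈⟨ +-identityʳ 1# ⟩
        1#             ∎

    fixpoint : ∀ {f g} → f ≈ g + t * f → (1# - t) * f ≈ g
    fixpoint {f} {g} f≈ = +-cancelʳ (t * f) _ _ (begin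
      d * f + t * f ≈⟨ distribʳ f d t ⟨
      (d + t) * f   ≈⟨ *-congʳ d+t≈1 ⟩
      1# * f        ≈⟨ *-identityˡ f ⟩
      f             ≈⟨ f≈ ⟩
      g + t * f     ∎)

    module _ {I : Carrier} (I≈ : I ≈ 1# + t * I) where
      -- By `fixpoint`, the hypothesis on `I` says (1 - t) I = 1; multiplying by `I` takes the place
      -- of dividing by 1 - t.
      fixpoint-unique : ∀ {f g} → f ≈ g + t * f → f ≈ I * g
      fixpoint-unique {f} {g} f≈ = begin
        f           ≈⟨ *-identityˡ f ⟨
        1# * f      ≈⟨ *-congʳ (fixpoint I≈) ⟨
        d * I * f   ≈⟨ solve 3 (λ d I f → d :* I :* f := I :* (d :* f)) refl d I f ⟩
        I * (d * f) ≈⟨ *-congˡ (fixpoint f≈) ⟩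
        I * g       ∎

      cube-inverse : I ^ 3 * (1# - t) ^ 3 ≈ 1#
      cube-inverse = begin
        I ^ 3 * d ^ 3
          ≈⟨ solve 2 (λ I d → I :^ 3 :* d :^ 3 := (d :* I) :* (d :* I) :* (d :* I)) refl I d ⟩
        (d * I) * (d * I) * (d * I)
          ≈⟨ *-cong (*-cong dI dI) dI ⟩
        1# * 1# * 1#
          ≈⟨ trans (*-identityʳ _) (*-identityʳ _) ⟩
        1# ∎
        where dI = fixpoint I≈

      -- With w = x + s and r = x + 2 s, `U` is `I * w` and `V` is `I * (2 · (t * U) + r)`. So `U`
      -- carries one factor `I` and `V` up to two, and each (1 - t) on the right cancels one factor
      -- of `I ^ 3`.
      rational-form : ∀ {c U V x s} → U ≈ (x + s) + t * U →
        V ≈ (2 · (t * U) + (x + 2 · s)) + t * V →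
        1# + U + c * (U * V) ≈
          ((1# - t) ^ 3 + (1# - t) ^ 2 * (x + s) + c * (x + s) * (t * x + (x + 2 · s))) * I ^ 3
      rational-form {c} {U} {V} {x} {s} U≈ V≈ = sym (begin
        (d ^ 3 + d ^ 2 * w + c * w * (t * x + r)) * I ^ 3
          ≈⟨ *-congʳ (+-congˡ (*-congˡ split)) ⟩
        (d ^ 3 + d ^ 2 * w + c * w * (2 · (t * w) + d * r)) * I ^ 3
          ≈⟨ solve 6 (λ d w c t r I →
               (d :^ 3 :+ d :^ 2 :* w :+ c :* w :* (2 :· (t :* w) :+ d :* r)) :* I :^ 3 :=
               (d :* I) :^ 3 :+ (d :* I) :^ 2 :* (I :* w)
               :+ c :* ((I :* w) :* (I :* (2 :· (t :* (I :* w)) :+ d :* I :* r))))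
               refl d w c t r I ⟩
        (d * I) ^ 3 + (d * I) ^ 2 * (I * w) + c * ((I * w) * (I * (2 · (t * (I * w)) + d * I * r)))
          ≈⟨ +-cong (+-cong (^-congˡ 3 dI) (*-cong (^-congˡ 2 dI) (sym U≈I*w)))
               (*-congˡ (*-cong (sym U≈I*w) (*-congˡ (+-cong (·-congʳ 2 (*-congˡ (sym U≈I*w))) (*-congʳ dI))))) ⟩
        1# ^ 3 + 1# ^ 2 * U + c * (U * (I * (2 · (t * U) + 1# * r)))
          ≈⟨ solve 5 (λ U c I t r →
               con 1 :^ 3 :+ con 1 :^ 2 :* U :+ c :* (U :* (I :* (2 :· (t :* U) :+ con 1 :* r))) :=
               con 1 :+ U :+ c :* (U :* (I :* (2 :· (t :* U) :+ r)))) refl U c I t r ⟩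
        1# + U + c * (U * (I * (2 · (t * U) + r)))
          ≈⟨ +-congˡ (*-congˡ (*-congˡ (fixpoint-unique V≈))) ⟨
        1# + U + c * (U * V) ∎)
        where
        w r : Carrier
        w = x + s
        r = x + 2 · s

        dI : d * I ≈ 1#
        dI = fixpoint I≈

        U≈I*w : U ≈ I * w
        U≈I*w = fixpoint-unique U≈

        -- The numerator of `V` over (1 - t)² is 2 t w + (1 - t) r. It collapses to t x + r because
        -- 2 (x + s) - (x + 2 s) = x.
        split : t * x + r ≈ 2 · (t * w) + d * r
        split = begin
          t * x + r             ≈⟨ +-congˡ (trans (*-congʳ d+t≈1) (*-identityˡ r)) ⟨
          t * x + (d + t) * r
            ≈⟨ solve 4 (λ t d x s → t :* x :+ (d :+ t) :* (x :+ 2 :· s) :=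
                 2 :· (t :* (x :+ s)) :+ d :* (x :+ 2 :· s)) refl t d x s ⟩
          2 · (t * w) + d * r   ∎

-- The series of ascending runs and their linear recurrences.

module GeneratingFunction (R : CommutativeRing 0ℓ 0ℓ) (p q y z : CommutativeRing.Carrier R) where
  private
    module R = CommutativeRing R
    module P = CommutativeRing (powerSeriesRing R)
  open R using (_≈_; _+_; _*_; 0#; 1#; refl; sym; trans; +-cong; +-congˡ; +-congʳ; *-congˡ)
  open RawSemiringDefinitions (RawRing.rawSemiring R.rawRing) using (_^_; _×_; sum)
  open import Algebra.Properties.Semiring.Mult R.semiring using (×-comm-*; ×-congʳ)
  open CauchyProduct R using (_◂_; const-⊛; var-⊛-zero; var-⊛-suc)
  open Numerator (powerSeriesRing R)
  open Solver R.commutativeSemiring using (solve; con; _:+_; _:*_; _:=_)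
  open ≈-Reasoning R.setoid

  open RawSemiringDefinitions (RawRing.rawSemiring P.rawRing)
    using () renaming (_^_ to _^ᵖ_; _×_ to _·_)

  X : P.Carrier
  X = var R.rawRing

  ⟨_⟩ : R.Carrier → P.Carrier
  ⟨_⟩ = const R.rawRing

  -- These are u and v. Runs are nonempty, and the value `0#` at length zero makes the Cauchy
  -- product of the two range over nonempty first runs only.
  run weightedRun : P.Carrier
  run zero        = 0#
  run (suc n)     = p ^ n * y ^ ⌊ suc n /2⌋
  weightedRun n   = n × run n

  -- The inverse of 1 - p² x² y.
  geometric : P.Carrier
  geometric zero          = 1#
  geometric (suc zero)    = 0#
  geometric (suc (suc n)) = p * (p * (y * geometric n))

  private
    t s : P.Carrier
    t = ⟨ p ⟩ ^ᵖ 2 P.* X ^ᵖ 2 P.* ⟨ y ⟩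
    s = ⟨ p ⟩ P.* X ^ᵖ 2 P.* ⟨ y ⟩

    shift : P.Carrier → P.Carrier
    shift f zero          = 0#
    shift f (suc zero)    = 0#
    shift f (suc (suc n)) = f n

    X*X* : ∀ f → X P.* (X P.* f) P.≈ shift f
    X*X* f zero          = var-⊛-zero (X P.* f)
    X*X* f (suc zero)    = trans (var-⊛-suc (X P.* f) 0) (var-⊛-zero f)
    X*X* f (suc (suc n)) = trans (var-⊛-suc (X P.* f) (suc n)) (var-⊛-suc f n)

    ⟨⟩*-≈ : ∀ a {f g} → f P.≈ g → ⟨ a ⟩ P.* f P.≈ a ◂ g
    ⟨⟩*-≈ a {f} f≈g = P.trans (const-⊛ a f) (λ n → *-congˡ (f≈g n))

    t*-≈ : ∀ f → t P.* f P.≈ p ◂ p ◂ y ◂ shift f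
    t*-≈ f = P.trans
      (S.solve 4 (λ p x y f → p S.:* (p S.:* S.con 1) S.:* (x S.:* (x S.:* S.con 1)) S.:* y S.:* f
                     S.:= p S.:* (p S.:* (y S.:* (x S.:* (x S.:* f))))) P.refl ⟨ p ⟩ X ⟨ y ⟩ f)
      (⟨⟩*-≈ p (⟨⟩*-≈ p (⟨⟩*-≈ y (X*X* f))))
      where module S = Solver P.commutativeSemiring

    s-≈ : s P.≈ p ◂ y ◂ shift P.1#
    s-≈ = P.trans
      (S.solve 3 (λ p x y → p S.:* (x S.:* (x S.:* S.con 1)) S.:* y
                     S.:= p S.:* (y S.:* (x S.:* (x S.:* S.con 1)))) P.refl ⟨ p ⟩ X ⟨ y ⟩)
      (⟨⟩*-≈ p (⟨⟩*-≈ y (X*X* P.1#)))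
      where module S = Solver P.commutativeSemiring

    run-step : ∀ n → run (3 ℕ.+ n) ≈ p * (p * (y * run (suc n)))
    run-step n = solve 4 (λ p y a b → p :* (p :* a) :* (y :* b) := p :* (p :* (y :* (a :* b))))
                   refl p y (p ^ n) (y ^ ⌊ suc n /2⌋)

    geometric-eq : geometric P.≈ P.1# P.+ t P.* geometric
    geometric-eq = P.trans coefficients (P.+-congˡ (P.sym (t*-≈ geometric)))
      where
      coefficients : geometric P.≈ P.1# P.+ (p ◂ p ◂ y ◂ shift geometric)
      coefficients zero          = solve 2 (λ p y → con 1 := con 1 :+ p :* (p :* (y :* con 0))) refl p y
      coefficients (suc zero)    = solve 2 (λ p y → con 0 := con 0 :+ p :* (p :* (y :* con 0))) refl p y
      coefficients (suc (suc n)) = sym (R.+-identityˡ _)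

    run-eq : run P.≈ (X P.+ s) P.+ t P.* run
    run-eq = P.trans coefficients (P.sym (P.+-cong (P.+-congˡ s-≈) (t*-≈ run)))
      where
      coefficients : run P.≈ (X P.+ (p ◂ y ◂ shift P.1#)) P.+ (p ◂ p ◂ y ◂ shift run)
      coefficients zero =
        solve 2 (λ p y → con 0 := (con 0 :+ p :* (y :* con 0)) :+ p :* (p :* (y :* con 0))) refl p y
      coefficients (suc zero) =
        solve 2 (λ p y → con 1 :* con 1 := (con 1 :+ p :* (y :* con 0)) :+ p :* (p :* (y :* con 0))) refl p y
      coefficients (suc (suc zero)) =
        solve 2 (λ p y → (p :* con 1) :* (y :* con 1) :=
                         (con 0 :+ p :* (y :* con 1)) :+ p :* (p :* (y :* con 0))) refl p y
      coefficients (suc (suc (suc n))) = trans (run-step n)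
        (solve 3 (λ p y a → a := (con 0 :+ p :* (y :* con 0)) :+ a) refl p y (p * (p * (y * run (suc n)))))

    -- Passing from length n to n + 2 multiplies the run by p² y and raises the multiplicity by two:
    -- the old multiplicity gives `t P.* weightedRun`, the increase gives `2 · (t P.* run)`. Lengths
    -- 1 and 2, with multiplicities 1 and 2, give `X P.+ 2 · s`.
    weightedRun-eq : weightedRun P.≈ (2 · (t P.* run) P.+ (X P.+ 2 · s)) P.+ t P.* weightedRun
    weightedRun-eq = P.trans coefficients (P.sym (P.+-cong
        (P.+-cong (double (t*-≈ run)) (P.+-congˡ (double s-≈))) (t*-≈ weightedRun)))
      where
      double : ∀ {f g} → f P.≈ g → 2 · f P.≈ 2 · g
      double f≈g = P.+-cong f≈g (P.+-congʳ f≈g)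

      coefficients : weightedRun P.≈ (2 · (p ◂ p ◂ y ◂ shift run) P.+ (X P.+ 2 · (p ◂ y ◂ shift P.1#)))
                                     P.+ (p ◂ p ◂ y ◂ shift weightedRun)
      coefficients zero =
        solve 2 (λ p y → let a = p :* (p :* (y :* con 0)); b = p :* (y :* con 0) in
          con 0 := ((a :+ (a :+ con 0)) :+ (con 0 :+ (b :+ (b :+ con 0)))) :+ a) refl p y
      coefficients (suc zero) =
        solve 2 (λ p y → let a = p :* (p :* (y :* con 0)); b = p :* (y :* con 0) in
          con 1 :* con 1 :+ con 0 := ((a :+ (a :+ con 0)) :+ (con 1 :+ (b :+ (b :+ con 0)))) :+ a) refl p y
      coefficients (suc (suc zero)) =
        solve 2 (λ p y → let a = p :* (p :* (y :* con 0)); b = p :* (y :* con 1); u = (p :* con 1) :* (y :* con 1) in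
          u :+ (u :+ con 0) := ((a :+ (a :+ con 0)) :+ (con 0 :+ (b :+ (b :+ con 0)))) :+ a) refl p y
      coefficients (suc (suc (suc n))) = begin
        u + (u + suc n × u)
          ≈⟨ +-cong (run-step n) (+-cong (run-step n) multiple) ⟩
        pull (run (suc n)) + (pull (run (suc n)) + pull (suc n × run (suc n)))
          ≈⟨ solve 4 (λ p y a c → let b = p :* (y :* con 0) in
               a :+ (a :+ c) := ((a :+ (a :+ con 0)) :+ (con 0 :+ (b :+ (b :+ con 0)))) :+ c)
               refl p y (pull (run (suc n))) (pull (suc n × run (suc n))) ⟩
        _ ∎
        where
        u : R.Carrier
        u = run (3 ℕ.+ n)

        pull : R.Carrier → R.Carrier
        pull a = p * (p * (y * a))

        multiple : suc n × u ≈ pull (suc n × run (suc n))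
        multiple = begin
          suc n × u                           ≈⟨ ×-congʳ (suc n) (run-step n) ⟩
          suc n × (p * (p * (y * run (suc n))))  ≈⟨ ×-comm-* (suc n) p _ ⟨
          p * (suc n × (p * (y * run (suc n))))  ≈⟨ *-congˡ (×-comm-* (suc n) p _) ⟨
          p * (p * (suc n × (y * run (suc n))))  ≈⟨ *-congˡ (*-congˡ (×-comm-* (suc n) y _)) ⟨
          pull (suc n × run (suc n))          ∎

  denominator-inverse : Invertible P._≈_ P.1# P._*_ ((P.1# - t) ^ᵖ 3)
  denominator-inverse = geometric ^ᵖ 3 , inverse , P.trans (P.*-comm _ (geometric ^ᵖ 3)) inverse
    where
    inverse : geometric ^ᵖ 3 P.* (P.1# - t) ^ᵖ 3 P.≈ P.1#
    inverse = cube-inverse {t} {geometric} geometric-eq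

  generating-function : ∀ f → f 0 ≈ 1# →
    (∀ m → f (suc m) ≈ run (suc m) + q * (z * sum {suc m} λ i → run (suc (toℕ i)) * weightedRun (m ∸ toℕ i))) →
    f P.≈ numerator X ⟨ p ⟩ ⟨ q ⟩ ⟨ y ⟩ ⟨ z ⟩ P.* geometric ^ᵖ 3
  generating-function f f0 f+ = P.trans coefficients (P.trans
    (rational-form {t} {geometric} geometric-eq {⟨ q ⟩ P.* ⟨ z ⟩} {run} {weightedRun} {X} {s} run-eq weightedRun-eq)
    (P.*-congʳ (P.sym (numerator-expand X ⟨ p ⟩ ⟨ q ⟩ ⟨ y ⟩ ⟨ z ⟩))))
    where
    product : ∀ n → (⟨ q ⟩ P.* ⟨ z ⟩ P.* (run P.* weightedRun)) n ≈ q * (z * (run P.* weightedRun) n)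
    product = P.trans (P.*-assoc ⟨ q ⟩ ⟨ z ⟩ _) (⟨⟩*-≈ q (const-⊛ z _))

    coefficients : f P.≈ P.1# P.+ run P.+ ⟨ q ⟩ P.* ⟨ z ⟩ P.* (run P.* weightedRun)
    coefficients zero = trans f0 (trans
      (solve 2 (λ q z → con 1 := con 1 :+ con 0 :+ q :* (z :* (con 0 :* con 0 :+ con 0))) refl q z)
      (+-congˡ (sym (product 0))))
    coefficients (suc m) = trans (f+ m) (trans
      -- The summand `con 0 :* w` is `run 0 * weightedRun (suc m)`, the first term of the Cauchy
      -- product, which is absent from the sum in the hypothesis.
      (solve 5 (λ q z u v w → u :+ q :* (z :* v) := con 0 :+ u :+ q :* (z :* (con 0 :* w :+ v)))
        refl q z _ _ (weightedRun (suc m)))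
      (+-congˡ (sym (product (suc m)))))

-- Exchanges of two adjacent blocks: their letters and inversions.

module Avoiders where
  open import Data.Bool.Base using (Bool; true; false)
  open import Data.Fin.Base using (inject₁; fromℕ<; punchOut)
  open import Data.Fin.Patterns using (0F; 1F; 2F)
  open import Data.Fin.Properties as Fin
    using (toℕ-inject₁; toℕ-fromℕ<; toℕ-injective; punchOut-injective; injective⇒≤; any?; all?)
  open import Data.Fin.Subset using (Subset; ∣_∣)
  open import Data.List.Base using (replicate)
  open import Data.List.Extrema.Nat using (max≈v⁺)
  open import Data.List.Membership.Propositional using () renaming (_∈_ to _∈ˡ_)
  open import Data.List.Membership.Propositional.Properties
    using ( ∈-map⁺; ∈-filter⁺; ∈-filter⁻; ∈-cartesianProductWith⁺; ∈-allFin; ∈-concat⁺′; ∈-concat⁻′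
          ; ∈-tabulate⁺; ∈-tabulate⁻)
  open import Data.List.Membership.Propositional.Properties.WithK using (unique∧set⇒bag)
  open import Data.List.Relation.Binary.BagAndSetEquality using (∼bag⇒↭)
  open import Data.List.Relation.Binary.Disjoint.Propositional using (Disjoint)
  import Data.List.Relation.Unary.All as All
  import Data.List.Relation.Unary.All.Properties as All
  import Data.List.Relation.Unary.AllPairs as AllPairs
  import Data.List.Relation.Unary.AllPairs.Properties as AllPairs
  open import Data.List.Relation.Unary.Any using (here; there)
  import Data.List.Relation.Unary.Unique.Propositional as List
  import Data.List.Relation.Unary.Unique.Propositional.Properties as Listᵘ
  open import Data.Nat.Base using (_+_; _<_; s≤s)
  open import Data.Nat.Properties
  open import Data.Product using (∃; ∃₂; _×_; proj₁; proj₂)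
  open import Data.Sum using (_⊎_; inj₁; inj₂)
  open import Data.Vec.Base as Vec using (Vec; []; _∷_; lookup; here; there)
  open import Data.Vec.Properties using (tabulate∘lookup; tabulate-cong; lookup∘tabulate; ∷-injective)
  open import Data.Vec.Relation.Unary.Unique.Propositional using (Unique)
  open import Data.Vec.Relation.Unary.Unique.Propositional.Properties using (lookup-injective; tabulate⁺)
  open import Function.Base using (id)
  open import Function.Bundles using (mk⇔; module Equivalence)
  open import Relation.Binary.Definitions using (tri<; tri≈; tri>)
  open import Relation.Binary.PropositionalEquality
    using (_≢_; refl; sym; trans; cong; cong₂; subst; subst₂)
  open import Relation.Nullary using (¬_; yes; no; does; contradiction)
  open import Relation.Nullary.Decidable using (from-yes; _→-dec_; _×-dec_; dec-true; dec-false)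
  open import Relation.Unary using (Pred; Decidable)

  -- Zero-based, the word b, ..., a+b-1, 0, ..., b-1, a+b, a+b+1, ... as a function on all of `ℕ`,
  -- independent of the length n. Sizes 0 and 0 give the identity.
  rotated : ℕ → ℕ → ℕ → ℕ
  rotated a b i with i <? a | i <? a + b
  ... | yes _ | _     = b + i
  ... | no _  | yes _ = i ∸ a
  ... | no _  | no _  = i

  rotated-left : ∀ {a} b {i} → i < a → rotated a b i ≡ b + i
  rotated-left {a} b {i} i<a with i <? a
  ... | yes _  = refl
  ... | no i≮a = contradiction i<a i≮a

  rotated-middle : ∀ a {b j} → j < b → rotated a b (a + j) ≡ j
  rotated-middle a {b} {j} j<b with a + j <? a | a + j <? a + b
  ... | yes a+j<a | _         = contradiction (m≤m+n a j) (<⇒≱ a+j<a)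
  ... | no _      | yes _     = m+n∸m≡n a j
  ... | no _      | no a+j≮a+b = contradiction (+-monoʳ-< a j<b) a+j≮a+b

  rotated-right : ∀ a b {i} → a + b ≤ i → rotated a b i ≡ i
  rotated-right a b {i} a+b≤i with i <? a | i <? a + b
  ... | yes i<a | _         = contradiction (≤-trans (m≤m+n a b) a+b≤i) (<⇒≱ i<a)
  ... | no _    | yes i<a+b = contradiction a+b≤i (<⇒≱ i<a+b)
  ... | no _    | no _      = refl

  -- Indexing `middle` by `a + j` lets a match expose the offset `j`, so that the truncated
  -- subtraction in `rotated` disappears.
  data Block (a b : ℕ) : ℕ → Set where
    left   : ∀ {i} → i < a → Block a b i
    middle : ∀ {j} → j < b → Block a b (a + j)
    right  : ∀ {i} → a + b ≤ i → Block a b i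

  block : ∀ a b i → Block a b i
  block a b i with i <? a
  ... | yes i<a = left i<a
  ... | no i≮a with m≤n⇒∃[o]m+o≡n (≮⇒≥ i≮a)
  ...   | j , refl with j <? b
  ...     | yes j<b = middle j<b
  ...     | no j≮b  = right (+-monoʳ-≤ a (≮⇒≥ j≮b))

  rotated-< : ∀ {a b n i} → a + b ≤ n → i < n → rotated a b i < n
  rotated-< {a} {b} {n} {i} a+b≤n i<n with block a b i
  ... | left i<a   rewrite rotated-left b i<a        =
    <-≤-trans (+-monoʳ-< b i<a) (subst (_≤ n) (+-comm a b) a+b≤n)
  ... | middle {j} j<b rewrite rotated-middle a j<b    = ≤-<-trans (m≤n+m j a) i<n
  ... | right ≤i   rewrite rotated-right a b ≤i      = i<n

  -- The only inversions are between the left and the middle block.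
  Inversion : ℕ → ℕ → ℕ → ℕ → Set
  Inversion a b i j = i < a × a ≤ j × j < a + b

  -- The single case analysis over pairs of blocks; injectivity, both directions of the inversion
  -- criterion and the ascents are read off from it.
  rotated-compare : ∀ a b {i j} → i < j →
    rotated a b i < rotated a b j ⊎ Inversion a b i j × rotated a b j < rotated a b i
  rotated-compare a b {i} {j} i<j with block a b i | block a b j
  ... | left i<a | left j<a rewrite rotated-left b i<a | rotated-left b j<a = inj₁ (+-monoʳ-< b i<j)
  ... | left i<a | middle {k} k<b rewrite rotated-left b i<a | rotated-middle a k<b =
    inj₂ ((i<a , m≤m+n a k , +-monoʳ-< a k<b) , <-≤-trans k<b (m≤m+n b i))
  ... | left i<a | right ≤j rewrite rotated-left b i<a | rotated-right a b ≤j =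
    inj₁ (<-≤-trans (+-monoʳ-< b i<a) (subst (_≤ j) (+-comm a b) ≤j))
  ... | middle {k} k<b | left j<a = contradiction (≤-trans (m≤m+n a k) (<⇒≤ i<j)) (<⇒≱ j<a)
  ... | middle {k} k<b | middle {l} l<b rewrite rotated-middle a k<b | rotated-middle a l<b =
    inj₁ (+-cancelˡ-< a k l i<j)
  ... | middle {k} k<b | right ≤j rewrite rotated-middle a k<b | rotated-right a b ≤j =
    inj₁ (<-≤-trans k<b (≤-trans (m≤n+m b a) ≤j))
  ... | right ≤i | left j<a = contradiction (≤-trans (m≤m+n a b) (≤-trans ≤i (<⇒≤ i<j))) (<⇒≱ j<a)
  ... | right ≤i | middle {l} l<b = contradiction (≤-trans ≤i (<⇒≤ i<j)) (<⇒≱ (+-monoʳ-< a l<b))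
  ... | right ≤i | right ≤j rewrite rotated-right a b ≤i | rotated-right a b ≤j = inj₁ i<j

  rotated-inversion : ∀ a b {i j} → i < j → rotated a b j < rotated a b i → Inversion a b i j
  rotated-inversion a b i<j gt with rotated-compare a b i<j
  ... | inj₁ lt        = contradiction gt (<-asym lt)
  ... | inj₂ (inv , _) = inv

  inversion-rotated : ∀ a b {i j} → Inversion a b i j → rotated a b j < rotated a b i
  inversion-rotated a b {i} {j} (i<a , a≤j , j<a+b) with rotated-compare a b (<-≤-trans i<a a≤j) | m≤n⇒∃[o]m+o≡n a≤j
  ... | inj₂ (_ , gt) | _        = gt
  ... | inj₁ lt       | k , refl rewrite rotated-left b i<a | rotated-middle a (+-cancelˡ-< a k b j<a+b) =
    <-≤-trans (+-cancelˡ-< a k b j<a+b) (m≤m+n b i)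

  rotated-injective : ∀ a b {i j} → rotated a b i ≡ rotated a b j → i ≡ j
  rotated-injective a b {i} {j} eq with <-cmp i j
  ... | tri≈ _ i≡j _ = i≡j
  ... | tri< i<j _ _ with rotated-compare a b i<j
  ...   | inj₁ lt       = contradiction eq (<⇒≢ lt)
  ...   | inj₂ (_ , gt) = contradiction (sym eq) (<⇒≢ gt)
  rotated-injective a b {i} {j} eq | tri> _ _ j<i with rotated-compare a b j<i
  ...   | inj₁ lt       = contradiction (sym eq) (<⇒≢ lt)
  ...   | inj₂ (_ , gt) = contradiction eq (<⇒≢ gt)

  -- Classification of the avoiders.

  -- Applied towards both ends of an increasing stretch: once the extreme letters are bounded, the
  -- lower and the upper bound for each letter coincide.
  increasing-gap : ∀ {k} (g : ℕ → ℕ) → (∀ {i j} → i < j → j ≤ k → g i < g j) →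
    ∀ i d → i + d ≤ k → g i + d ≤ g (i + d)
  increasing-gap g inc i zero    _     rewrite +-identityʳ i | +-identityʳ (g i) = ≤-refl
  increasing-gap {k} g inc i (suc d) i+d≤k rewrite +-suc i d | +-suc (g i) d =
    ≤-<-trans (increasing-gap g inc i d (<⇒≤ i+d≤k)) (inc ≤-refl i+d≤k)

  module _ {n : ℕ} {f : ℕ → ℕ}
    (f< : ∀ {i} → i < n → f i < n)
    (f-injective : ∀ {i j} → i < n → j < n → f i ≡ f j → i ≡ j)
    (f-surjective : ∀ {v} → v < n → ∃ λ i → i < n × f i ≡ v)
    (no132 : ∀ {i j k} → i < j → j < k → k < n → f i < f k → ¬ f k < f j)
    (no321 : ∀ {i j k} → i < j → j < k → k < n → f k < f j → ¬ f j < f i)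
    where

    Classified : Set
    Classified = (∀ {i} → i < n → f i ≡ i) ⊎
      ∃₂ λ a b → suc a + suc b ≤ n × (∀ {i} → i < n → f i ≡ rotated (suc a) (suc b) i)

    private
      ≮∧≢⇒> : ∀ {i j} → ¬ i < j → i ≢ j → j < i
      ≮∧≢⇒> i≮j i≢j = ≤∧≢⇒< (≮⇒≥ i≮j) (λ j≡i → i≢j (sym j≡i))

      -- All positions beyond `M` are fixed, and the letter `M` stands at the earlier position `a`.
      -- It is thus the largest letter on positions 0, ..., `M` and serves as the 3 of the forbidden
      -- patterns. Writing `M` as `suc a + b′` makes b = b′ + 1 the number of positions after `a` up
      -- to `M`.
      module Rotation (a b′ : ℕ) (M<n : suc a + b′ < n)
        (fixed : ∀ {i} → suc a + b′ < i → i < n → f i ≡ i) (fa≡M : f a ≡ suc a + b′) where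

        M : ℕ
        M = suc a + b′

        <n : ∀ {i} → i ≤ M → i < n
        <n i≤M = ≤-<-trans i≤M M<n

        a<M : a < M
        a<M = s≤s (m≤m+n a b′)

        f≤M : ∀ {i} → i ≤ M → f i ≤ M
        f≤M {i} i≤M with f i ≤? M
        ... | yes fi≤M = fi≤M
        ... | no fi≰M  = contradiction
          (f-injective (<n i≤M) (f< (<n i≤M)) (sym (fixed (≰⇒> fi≰M) (f< (<n i≤M)))))
          (<⇒≢ (≤-<-trans i≤M (≰⇒> fi≰M)))

        below-max : ∀ {i} → i ≤ M → i ≢ a → f i < f a
        below-max i≤M i≢a = subst (f _ <_) (sym fa≡M)
          (≤∧≢⇒< (f≤M i≤M) (λ fi≡M → i≢a (f-injective (<n i≤M) (<n (<⇒≤ a<M)) (trans fi≡M (sym fa≡M)))))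

        f-≢ : ∀ {i j} → i < j → j ≤ M → f i ≢ f j
        f-≢ i<j j≤M eq = <⇒≢ i<j (f-injective (<n (<⇒≤ (<-≤-trans i<j j≤M))) (<n j≤M) eq)

        -- A descent to the right of `a` would form 321 together with the letter at `a`.
        right-increasing : ∀ {i j} → a < i → i < j → j ≤ M → f i < f j
        right-increasing {i} {j} a<i i<j j≤M with f i <? f j
        ... | yes fi<fj = fi<fj
        ... | no fi≮fj  = contradiction (below-max (<⇒≤ (<-≤-trans i<j j≤M)) (λ i≡a → <⇒≢ a<i (sym i≡a)))
          (no321 a<i i<j (<n j≤M) (≮∧≢⇒> fi≮fj (f-≢ i<j j≤M)))

        -- A smaller letter to the left of `a` would form 132 with the letter at `a` and the one at
        -- `j`.
        left-above-right : ∀ {i j} → i ≤ a → a < j → j ≤ M → f j < f i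
        left-above-right {i} {j} i≤a a<j j≤M with f i <? f j
        ... | no fi≮fj  = ≮∧≢⇒> fi≮fj (f-≢ (≤-<-trans i≤a a<j) j≤M)
        ... | yes fi<fj with m≤n⇒m<n∨m≡n i≤a
        ...   | inj₁ i<a  = contradiction (below-max j≤M (λ j≡a → <⇒≢ a<j (sym j≡a)))
          (no132 i<a a<j (<n j≤M) fi<fj)
        ...   | inj₂ refl = contradiction fi<fj (<-asym (below-max j≤M (λ j≡a → <⇒≢ a<j (sym j≡a))))

        left-increasing : ∀ {i j} → i < j → j ≤ a → f i < f j
        left-increasing {i} {j} i<j j≤a with f i <? f j
        ... | yes fi<fj = fi<fj
        ... | no fi≮fj  = contradiction (≮∧≢⇒> fi≮fj (f-≢ i<j (≤-trans j≤a (<⇒≤ a<M))))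
          (no321 i<j (≤-<-trans j≤a a<M) M<n (left-above-right j≤a a<M ≤-refl))

        right-gap : ∀ j d → j + d ≤ b′ → f (suc a + j) + d ≤ f (suc a + (j + d))
        right-gap = increasing-gap (λ j → f (suc a + j)) (λ i<j j≤b′ →
          right-increasing (s≤s (m≤m+n a _)) (+-monoʳ-< (suc a) i<j) (+-monoʳ-≤ (suc a) j≤b′))

        -- The letters at `suc a`, ..., `M` increase, so the last is at least `b′`, and the letter
        -- at 0 lies above it.
        b≤f0 : suc b′ ≤ f 0
        b≤f0 = ≤-<-trans (m+n≤o⇒n≤o (f (suc a + 0)) (right-gap 0 b′ ≤-refl))
          (left-above-right z≤n (s≤s (m≤m+n a b′)) ≤-refl)

        -- Counting up from position 0 gives the lower bound, counting down from the letter `M` at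
        -- `a` the upper one.
        f-left : ∀ {i} → i ≤ a → f i ≡ suc b′ + i
        f-left {i} i≤a with m≤n⇒∃[o]m+o≡n i≤a
        ... | d , refl = ≤-antisym
          (+-cancelʳ-≤ d (f i) _ (subst (f i + d ≤_)
            (trans fa≡M (trans (cong suc (+-comm (i + d) b′)) (sym (+-assoc (suc b′) i d))))
            (increasing-gap f left-increasing i d ≤-refl)))
          (≤-trans (+-monoˡ-≤ i b≤f0) (increasing-gap f left-increasing 0 i i≤a))

        -- The lower bound counts up from a first letter that is at least 0. The upper one counts
        -- down from position `M`, whose letter is below that at 0, now known to be `suc b′`.
        f-middle : ∀ {j} → j ≤ b′ → f (suc a + j) ≡ j
        f-middle {j} j≤b′ with m≤n⇒∃[o]m+o≡n j≤b′
        ... | d , refl = ≤-antisym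
          (+-cancelʳ-≤ d _ j (≤-trans (right-gap j d ≤-refl)
            (s≤s⁻¹ (subst (f M <_) (trans (f-left z≤n) (+-identityʳ (suc b′)))
              (left-above-right z≤n (s≤s (m≤m+n a b′)) ≤-refl)))))
          (m+n≤o⇒n≤o (f (suc a + 0)) (right-gap 0 j j≤b′))

        f-rotated : ∀ {i} → i < n → f i ≡ rotated (suc a) (suc b′) i
        f-rotated {i} i<n with block (suc a) (suc b′) i
        ... | left (s≤s i≤a)     = trans (f-left i≤a) (sym (rotated-left (suc b′) (s≤s i≤a)))
        ... | middle (s≤s j≤b′)  = trans (f-middle j≤b′) (sym (rotated-middle (suc a) (s≤s j≤b′)))
        ... | right ≤i           = trans (fixed (subst (_≤ i) (+-suc (suc a) b′) ≤i) i<n)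
                                         (sym (rotated-right (suc a) (suc b′) ≤i))

      -- Trailing fixed points are stripped off one at a time. At the last moved position `M`, the
      -- letter `M` must stand strictly earlier, since later positions hold their own letters; this
      -- is the situation of `Rotation`.
      fixed-from : ∀ N → N ≤ n → (∀ {i} → N ≤ i → i < n → f i ≡ i) → Classified
      fixed-from zero    _     fixed = inj₁ (fixed z≤n)
      fixed-from (suc M) M<n fixed with f M ≟ M
      ... | yes fM≡M = fixed-from M (<⇒≤ M<n) λ M≤i i<n → fixed′ (m≤n⇒m<n∨m≡n M≤i) i<n
        where
        fixed′ : ∀ {i} → M < i ⊎ M ≡ i → i < n → f i ≡ i
        fixed′ (inj₁ M<i)  = fixed M<i
        fixed′ (inj₂ refl) _ = fM≡M
      ... | no fM≢M with f-surjective M<n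
      ...   | a , a<n , fa≡M with <-cmp a M
      ...     | tri≈ _ refl _ = contradiction fa≡M fM≢M
      ...     | tri> _ _ M<a  = contradiction (trans (sym (fixed M<a a<n)) fa≡M) (λ a≡M → <⇒≢ M<a (sym a≡M))
      ...     | tri< a<M _ _ with m≤n⇒∃[o]m+o≡n a<M
      ...       | b′ , refl = inj₂ (a , b′ , subst (_≤ n) (sym (+-suc (suc a) b′)) M<n , f-rotated)
        where open Rotation a b′ M<n fixed fa≡M

    classify : Classified
    classify = fixed-from n ≤-refl (λ n≤i i<n → contradiction n≤i (<⇒≱ i<n))

  -- Membership in the avoidance class, and occurrences of patterns.

  allVecs-unique : ∀ {A : Set} {xs : List A} → List.Unique xs → ∀ n → List.Unique (allVecs xs n)
  allVecs-unique xs! zero    = All.[] AllPairs.∷ AllPairs.[]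
  allVecs-unique xs! (suc n) = Listᵘ.cartesianProductWith⁺ _∷_ ∷-injective xs! (allVecs-unique xs! n)

  ∈-allVecs : ∀ {A : Set} {xs : List A} → (∀ x → x ∈ˡ xs) → ∀ {n} (v : Vec A n) → v ∈ˡ allVecs xs n
  ∈-allVecs ∈xs []      = here refl
  ∈-allVecs ∈xs (x ∷ v) = ∈-cartesianProductWith⁺ _∷_ (∈xs x) (∈-allVecs ∈xs v)

  module _ {n k l : ℕ} {τ : Word k} {ρ : Word l} where
    private
      avoidsBoth? = λ (π : Word n) → avoids? π τ ×-dec avoids? π ρ

    S-unique : List.Unique (S n τ ρ)
    S-unique = Listᵘ.filter⁺ avoidsBoth? (Listᵘ.filter⁺ unique? (allVecs-unique (Listᵘ.allFin⁺ n) n))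

    ∈-S⁺ : ∀ {π} → Unique π → Avoids π τ → Avoids π ρ → π ∈ˡ S n τ ρ
    ∈-S⁺ {π} π! πτ πρ = ∈-filter⁺ avoidsBoth? (∈-filter⁺ unique? (∈-allVecs ∈-allFin π) π!) (πτ , πρ)

    ∈-S⁻ : ∀ {π} → π ∈ˡ S n τ ρ → Unique π × Avoids π τ × Avoids π ρ
    ∈-S⁻ π∈ with ∈-filter⁻ avoidsBoth? π∈
    ... | π∈′ , avoid = proj₂ (∈-filter⁻ unique? {xs = allVecs (List.allFin n) n} π∈′) , avoid

  -- If `v` were missed, `punchOut` at `v` would inject `Fin (suc n)` into `Fin n`.
  injective⇒surjective : ∀ {n} {f : Fin n → Fin n} → (∀ {i j} → f i ≡ f j → i ≡ j) → ∀ v → ∃ λ i → f i ≡ v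
  injective⇒surjective {suc n} {f} f-inj v with any? (λ i → f i Fin.≟ v)
  ... | yes hit = hit
  ... | no miss = contradiction
    (injective⇒≤ {f = λ i → punchOut (miss′ i)}
      (λ {i} {j} eq → f-inj (punchOut-injective (miss′ i) (miss′ j) eq)))
    1+n≰n
    where
    miss′ : ∀ i → v ≢ f i
    miss′ i v≡fi = miss (i , sym v≡fi)

  module _ {n k} {π : Word n} {τ : Word k} (τ-injective : ∀ a b → lookup τ a ≡ lookup τ b → a ≡ b) where
    -- One implication of the order condition suffices: the letters of `τ` are distinct, so
    -- trichotomy yields the converse.
    occurrence : ∀ is → (∀ a b → a Fin.< b → lookup is a Fin.< lookup is b) →
      (∀ a b → lookup τ a Fin.< lookup τ b → lookup π (lookup is a) Fin.< lookup π (lookup is b)) →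
      Occurrence π τ is
    occurrence is increasing monotone = increasing , λ a b → mk⇔ (reflects a b) (monotone a b)
      where
      reflects : ∀ a b → lookup π (lookup is a) Fin.< lookup π (lookup is b) → lookup τ a Fin.< lookup τ b
      reflects a b lt with Fin.<-cmp (lookup τ a) (lookup τ b)
      ... | tri< τa<τb _ _ = τa<τb
      ... | tri> _ _ τb<τa = contradiction lt (<-asym (monotone b a τb<τa))
      ... | tri≈ _ τa≡τb _ with τ-injective a b τa≡τb
      ...   | refl = contradiction lt (<-irrefl refl)

  module _ {n} {π : Word n} {i j k : Fin n} (i<j : i Fin.< j) (j<k : j Fin.< k) where
    private
      positions-increasing : ∀ a b → a Fin.< b → lookup (i ∷ j ∷ k ∷ []) a Fin.< lookup (i ∷ j ∷ k ∷ []) b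
      positions-increasing 0F 0F ()
      positions-increasing 0F 1F _ = i<j
      positions-increasing 0F 2F _ = <-trans i<j j<k
      positions-increasing 1F 0F ()
      positions-increasing 1F 1F (s≤s ())
      positions-increasing 1F 2F _ = j<k
      positions-increasing 2F 0F ()
      positions-increasing 2F 1F (s≤s ())
      positions-increasing 2F 2F (s≤s (s≤s ()))

      module _ (τ : Word 3) where
        injective? = all? λ a → all? λ b → (lookup τ a Fin.≟ lookup τ b) →-dec (a Fin.≟ b)

    occurrence-132 : lookup π i Fin.< lookup π k → lookup π k Fin.< lookup π j → ∃ (Occurrence π [132])
    occurrence-132 πi<πk πk<πj = i ∷ j ∷ k ∷ [] ,
      occurrence {π = π} {[132]} (from-yes (injective? [132])) (i ∷ j ∷ k ∷ []) positions-increasing λ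
        { 0F 0F () ; 0F 1F _ → <-trans πi<πk πk<πj ; 0F 2F _ → πi<πk
        ; 1F 0F () ; 1F 1F (s≤s (s≤s ())) ; 1F 2F (s≤s ())
        ; 2F 0F () ; 2F 1F _ → πk<πj ; 2F 2F (s≤s ()) }

    occurrence-321 : lookup π k Fin.< lookup π j → lookup π j Fin.< lookup π i → ∃ (Occurrence π [321])
    occurrence-321 πk<πj πj<πi = i ∷ j ∷ k ∷ [] ,
      occurrence {π = π} {[321]} (from-yes (injective? [321])) (i ∷ j ∷ k ∷ []) positions-increasing λ
        { 0F 0F (s≤s (s≤s ())) ; 0F 1F (s≤s ()) ; 0F 2F ()
        ; 1F 0F _ → πj<πi ; 1F 1F (s≤s ()) ; 1F 2F ()
        ; 2F 0F _ → <-trans πk<πj πj<πi ; 2F 1F _ → πk<πj ; 2F 2F () }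

  -- Block exchanges as words: avoidance, distinctness, completeness.

  -- The bound is irrelevant, so words with equal block sizes are equal by computation whatever the
  -- proofs of the bound.
  rotatedWord : ∀ {n} a b → .(a + b ≤ n) → Word n
  rotatedWord a b a+b≤n = Vec.tabulate λ i → fromℕ< (rotated-< {a} {b} a+b≤n (toℕ<n i))

  module _ {n} (a b : ℕ) .(a+b≤n : a + b ≤ n) where
    lookup-rotatedWord : ∀ i → toℕ (lookup (rotatedWord a b a+b≤n) i) ≡ rotated a b (toℕ i)
    lookup-rotatedWord i = trans (cong toℕ (lookup∘tabulate _ i)) (toℕ-fromℕ< _)

    rotatedWord-unique : Unique (rotatedWord a b a+b≤n)
    rotatedWord-unique = tabulate⁺ λ eq → toℕ-injective (rotated-injective a b
      (trans (sym (toℕ-fromℕ< _)) (trans (cong toℕ eq) (toℕ-fromℕ< _))))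

    private
      module _ {τ : Word 3} {is : Vec (Fin n) 3} (occ : Occurrence (rotatedWord a b a+b≤n) τ is) where
        position : Fin 3 → ℕ
        position c = toℕ (lookup is c)

        position-< : ∀ c d → c Fin.< d → position c < position d
        position-< = proj₁ occ

        value-< : ∀ c d → lookup τ c Fin.< lookup τ d → rotated a b (position c) < rotated a b (position d)
        value-< c d τc<τd = subst₂ _<_ (lookup-rotatedWord (lookup is c)) (lookup-rotatedWord (lookup is d))
          (Equivalence.from (proj₂ occ c d) τc<τd)

        inversion : ∀ c d → c Fin.< d → lookup τ d Fin.< lookup τ c → Inversion a b (position c) (position d)
        inversion c d c<d τd<τc = rotated-inversion a b (position-< c d c<d) (value-< d c τd<τc)

    -- The 3 and the 2 form an inversion, so the 3 lies in the left block. Then so does the earlier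
    -- 1, which makes the 1 and the 2 an inversion as well.
    rotatedWord-avoids-132 : Avoids (rotatedWord a b a+b≤n) [132]
    rotatedWord-avoids-132 (is , occ) with inversion {[132]} {is} occ 1F 2F (s≤s (s≤s z≤n)) (s≤s (s≤s z≤n))
    ... | j<a , jk = contradiction (value-< {[132]} {is} occ 0F 2F (s≤s z≤n)) (<-asym (inversion-rotated a b
      (<-trans (position-< {[132]} {is} occ 0F 1F (s≤s z≤n)) j<a , jk)))

    -- As the end of one inversion and the start of another, the middle position would be both at
    -- least `a` and below `a`.
    rotatedWord-avoids-321 : Avoids (rotatedWord a b a+b≤n) [321]
    rotatedWord-avoids-321 (is , occ) = contradiction
      (proj₁ (proj₂ (inversion {[321]} {is} occ 0F 1F (s≤s z≤n) (s≤s (s≤s z≤n)))))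
      (<⇒≱ (proj₁ (inversion {[321]} {is} occ 1F 2F (s≤s (s≤s z≤n)) (s≤s z≤n))))

    ≡-rotatedWord : ∀ {π : Word n} → (∀ i → toℕ (lookup π i) ≡ rotated a b (toℕ i)) → π ≡ rotatedWord a b a+b≤n
    ≡-rotatedWord {π} eq = trans (sym (tabulate∘lookup π))
      (tabulate-cong λ i → toℕ-injective (trans (eq i) (sym (toℕ-fromℕ< _))))

  -- The first letter is the size of the second block, and the position of the letter 0 is the size
  -- of the first.
  rotatedWord-injective : ∀ {n a b c d} .(le : suc a + suc b ≤ n) .(le′ : suc c + suc d ≤ n) →
    rotatedWord (suc a) (suc b) le ≡ rotatedWord (suc c) (suc d) le′ → a ≡ c × b ≡ d
  rotatedWord-injective {n} {a} {b} {c} {d} le le′ eq = suc-injective a≡c , suc-injective b≡d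
    where
    agree : ∀ {i} → .(i < n) → rotated (suc a) (suc b) i ≡ rotated (suc c) (suc d) i
    agree i<n = subst (λ i → rotated (suc a) (suc b) i ≡ rotated (suc c) (suc d) i) (toℕ-fromℕ< i<n)
      (trans (sym (lookup-rotatedWord (suc a) (suc b) le (fromℕ< i<n)))
        (trans (cong (λ π → toℕ (lookup π (fromℕ< i<n))) eq) (lookup-rotatedWord (suc c) (suc d) le′ (fromℕ< i<n))))

    b≡d : suc b ≡ suc d
    b≡d = trans (sym (+-identityʳ (suc b))) (trans (sym (rotated-left {suc a} (suc b) {0} (s≤s z≤n)))
      (trans (agree {0} (<-≤-trans (s≤s z≤n) le))
        (trans (rotated-left {suc c} (suc d) {0} (s≤s z≤n)) (+-identityʳ (suc d)))))

    first-zero : ∀ a b → rotated (suc a) (suc b) (suc a) ≡ 0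
    first-zero a b = trans (cong (rotated (suc a) (suc b)) (sym (+-identityʳ (suc a))))
      (rotated-middle (suc a) {suc b} {0} (s≤s z≤n))

    a≡c : suc a ≡ suc c
    a≡c = rotated-injective (suc c) (suc d)
      (trans (sym (agree {suc a} (<-≤-trans (s≤s (m<m+n a {suc b} (s≤s z≤n))) le)))
        (trans (first-zero a b) (sym (first-zero c d))))

  -- The form in which `classify` takes a word. The default 0 past the end is harmless, as
  -- `classify` assumes and concludes something only about positions below n.
  letter : ∀ {m n} → Vec (Fin m) n → ℕ → ℕ
  letter []      _       = 0
  letter (x ∷ v) zero    = toℕ x
  letter (x ∷ v) (suc i) = letter v i

  letter-toℕ : ∀ {m n} (v : Vec (Fin m) n) i → letter v (toℕ i) ≡ toℕ (lookup v i)
  letter-toℕ (x ∷ v) zero    = refl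
  letter-toℕ (x ∷ v) (suc i) = letter-toℕ v i

  asFin : ∀ {i n} → i < n → ∃ λ (j : Fin n) → toℕ j ≡ i
  asFin i<n = fromℕ< i<n , toℕ-fromℕ< i<n

  classify-word : ∀ {n} (π : Word n) → Unique π → Avoids π [132] → Avoids π [321] →
    π ≡ rotatedWord 0 0 z≤n ⊎ ∃₂ λ a b → ∃ λ le → π ≡ rotatedWord (suc a) (suc b) le
  classify-word {n} π π! π132 π321 with classify {n} {letter π} letter-< letter-injective letter-surjective no132 no321
    where
    letter-< : ∀ {i} → i < n → letter π i < n
    letter-< i<n with asFin i<n
    ... | i , refl = subst (_< n) (sym (letter-toℕ π i)) (toℕ<n (lookup π i))

    letter-injective : ∀ {i j} → i < n → j < n → letter π i ≡ letter π j → i ≡ j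
    letter-injective i<n j<n eq with asFin i<n | asFin j<n
    ... | i , refl | j , refl = cong toℕ (lookup-injective π! i j
      (toℕ-injective (trans (sym (letter-toℕ π i)) (trans eq (letter-toℕ π j)))))

    letter-surjective : ∀ {v} → v < n → ∃ λ i → i < n × letter π i ≡ v
    letter-surjective v<n with asFin v<n
    ... | v , refl with injective⇒surjective (λ {i} {j} → lookup-injective π! i j) v
    ...   | i , πi≡v = toℕ i , toℕ<n i , trans (letter-toℕ π i) (cong toℕ πi≡v)

    letters-< : ∀ {i j} → letter π (toℕ i) < letter π (toℕ j) → lookup π i Fin.< lookup π j
    letters-< {i} {j} = subst₂ _<_ (letter-toℕ π i) (letter-toℕ π j)

    no132 : ∀ {i j k} → i < j → j < k → k < n → letter π i < letter π k → ¬ letter π k < letter π j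
    no132 i<j j<k k<n πi<πk πk<πj
      with asFin (<-trans i<j (<-trans j<k k<n)) | asFin (<-trans j<k k<n) | asFin k<n
    ... | i , refl | j , refl | k , refl =
      π132 (occurrence-132 {π = π} {i} {j} {k} i<j j<k (letters-< {i} {k} πi<πk) (letters-< {k} {j} πk<πj))

    no321 : ∀ {i j k} → i < j → j < k → k < n → letter π k < letter π j → ¬ letter π j < letter π i
    no321 i<j j<k k<n πk<πj πj<πi
      with asFin (<-trans i<j (<-trans j<k k<n)) | asFin (<-trans j<k k<n) | asFin k<n
    ... | i , refl | j , refl | k , refl =
      π321 (occurrence-321 {π = π} {i} {j} {k} i<j j<k (letters-< {k} {j} πk<πj) (letters-< {j} {i} πj<πi))
  ... | inj₁ fixed = inj₁ (≡-rotatedWord 0 0 z≤n λ i →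
    trans (sym (letter-toℕ π i)) (trans (fixed (toℕ<n i)) (sym (rotated-right 0 0 z≤n))))
  ... | inj₂ (a , b , le , rot) = inj₂ (a , b , le , ≡-rotatedWord (suc a) (suc b) le λ i →
    trans (sym (letter-toℕ π i)) (rot (toℕ<n i)))

  module _ (n : ℕ) where
    -- The indices are one less than the block sizes. For a given `a` there are n - (a + 1) choices
    -- of `b`, exactly the length of the second run.
    block-sizes : (a : Fin n) (b : Fin (n ∸ suc (toℕ a))) → suc (toℕ a) + suc (toℕ b) ≤ n
    block-sizes a b = subst (suc (toℕ a) + suc (toℕ b) ≤_) (m+[n∸m]≡n (toℕ<n a))
      (+-monoʳ-≤ (suc (toℕ a)) (toℕ<n b))

    rotationsFrom : Fin n → List (Word n)
    rotationsFrom a = List.tabulate λ b → rotatedWord (suc (toℕ a)) (suc (toℕ b)) (block-sizes a b)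

    avoiders : List (Word n)
    avoiders = rotatedWord 0 0 z≤n ∷ concat (List.tabulate rotationsFrom)

    ∈-rotations⁻ : ∀ {π} → π ∈ˡ concat (List.tabulate rotationsFrom) →
      ∃₂ λ a b → π ≡ rotatedWord (suc (toℕ a)) (suc (toℕ b)) (block-sizes a b)
    ∈-rotations⁻ π∈ with ∈-concat⁻′ (List.tabulate rotationsFrom) π∈
    ... | _ , π∈πs , πs∈ with ∈-tabulate⁻ πs∈
    ...   | a , refl = a , ∈-tabulate⁻ π∈πs

    ∈-rotations⁺ : ∀ {a b} (le : suc a + suc b ≤ n) →
      rotatedWord (suc a) (suc b) le ∈ˡ concat (List.tabulate rotationsFrom)
    ∈-rotations⁺ {a} {b} le with asFin {a} {n} (≤-trans (m≤m+n (suc a) (suc b)) le)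
    ... | a′ , refl
      with asFin {b} {n ∸ suc (toℕ a′)}
             (m+n≤o⇒m≤o∸n (suc b) (subst (_≤ n) (+-comm (suc (toℕ a′)) (suc b)) le))
    ...   | b′ , refl = ∈-concat⁺′ (∈-tabulate⁺ b′) (∈-tabulate⁺ a′)

    avoiders-unique : List.Unique avoiders
    avoiders-unique = All.tabulate not-rotation AllPairs.∷ Listᵘ.concat⁺
      (All.tabulate⁺ λ a → Listᵘ.tabulate⁺ λ {b} {b′} eq →
        toℕ-injective (proj₂ (rotatedWord-injective (block-sizes a b) (block-sizes a b′) eq)))
      (AllPairs.tabulate⁺ disjoint)
      where
      -- The identity starts with the letter 0, a proper exchange with the positive size of its
      -- second block.
      not-rotation : ∀ {π} → π ∈ˡ concat (List.tabulate rotationsFrom) → rotatedWord 0 0 z≤n ≢ π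
      not-rotation π∈ eq with ∈-rotations⁻ π∈
      ... | a , b , refl with asFin {0} {n} (<-≤-trans (s≤s z≤n) (toℕ<n a))
      ...   | i , i≡0 = contradiction
        (trans (sym (lookup-rotatedWord 0 0 z≤n i)) (trans (cong (λ π → toℕ (lookup π i)) eq)
          (lookup-rotatedWord (suc (toℕ a)) (suc (toℕ b)) (block-sizes a b) i)))
        (subst (λ i → rotated 0 0 i ≢ rotated (suc (toℕ a)) (suc (toℕ b)) i) (sym i≡0)
          (λ eq → contradiction (trans eq (rotated-left {suc (toℕ a)} (suc (toℕ b)) {0} (s≤s z≤n))) λ ()))

      disjoint : ∀ {a a′} → a ≢ a′ → Disjoint (rotationsFrom a) (rotationsFrom a′)
      disjoint {a} {a′} a≢a′ (π∈ , π∈′) with ∈-tabulate⁻ π∈ | ∈-tabulate⁻ π∈′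
      ... | b , refl | b′ , eq = a≢a′
        (toℕ-injective (proj₁ (rotatedWord-injective (block-sizes a b) (block-sizes a′ b′) eq)))

    -- Duplicate-free lists with the same members are permutations of one another.
    ↭-avoiders : ∀ {πs : List (Word n)} → List.Unique πs →
      (∀ {π} → π ∈ˡ πs → Unique π × Avoids π [132] × Avoids π [321]) →
      (∀ {π} → Unique π → Avoids π [132] → Avoids π [321] → π ∈ˡ πs) →
      πs ↭ avoiders
    ↭-avoiders {πs} πs! ∈⁻ ∈⁺ = ∼bag⇒↭ (unique∧set⇒bag πs! avoiders-unique (mk⇔ to from))
      where
      to : ∀ {π} → π ∈ˡ πs → π ∈ˡ avoiders
      to {π} π∈ with ∈⁻ π∈
      ... | π! , π132 , π321 with classify-word π π! π132 π321
      ...   | inj₁ refl                = here refl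
      ...   | inj₂ (a , b , le , refl) = there (∈-rotations⁺ le)

      rotatedWord∈ : ∀ a b (le : a + b ≤ n) → rotatedWord a b le ∈ˡ πs
      rotatedWord∈ a b le = ∈⁺ (rotatedWord-unique a b le) (rotatedWord-avoids-132 a b le) (rotatedWord-avoids-321 a b le)

      from : ∀ {π} → π ∈ˡ avoiders → π ∈ˡ πs
      from (here refl) = rotatedWord∈ 0 0 z≤n
      from (there π∈) with ∈-rotations⁻ π∈
      ... | a , b , refl = rotatedWord∈ (suc (toℕ a)) (suc (toℕ b)) (block-sizes a b)

    S↭avoiders : S n [132] [321] ↭ avoiders
    S↭avoiders = ↭-avoiders {S n [132] [321]} (S-unique {n} {3} {3} {[132]} {[321]})
      (∈-S⁻ {n} {3} {3} {[132]} {[321]}) (∈-S⁺ {n} {3} {3} {[132]} {[321]})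

  -- Statistics as functions of the word of ascent or descent marks.

  trues packing : List Bool → ℕ
  trues []          = 0
  trues (true ∷ l)  = suc (trues l)
  trues (false ∷ l) = trues l

  -- Greedily choosing the leftmost available ascent is optimal.
  packing []              = 0
  packing (false ∷ l)     = packing l
  packing (true ∷ [])     = 1
  packing (true ∷ _ ∷ l)  = suc (packing l)

  -- The two bounds feed each other: a leading `true` swallows the next mark, which turns either
  -- inequality into the other one for a shorter list.
  packing-∷-≥ : ∀ x l → packing l ≤ packing (x ∷ l)
  packing-∷-≤ : ∀ x l → packing (x ∷ l) ≤ suc (packing l)
  packing-∷-≥ false l       = ≤-refl
  packing-∷-≥ true  []      = z≤n
  packing-∷-≥ true  (y ∷ l) = packing-∷-≤ y l
  packing-∷-≤ false l       = n≤1+n _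
  packing-∷-≤ true  []      = ≤-refl
  packing-∷-≤ true  (y ∷ l) = s≤s (packing-∷-≥ y l)

  marks : ∀ {m} {P : Pred (Fin m) 0ℓ} → Decidable P → List Bool
  marks P? = List.tabulate (does ∘ P?)

  count-tabulate : ∀ {m n} {P : Pred (Fin m) 0ℓ} (P? : Decidable P) (f : Fin n → Fin m) →
    Vec.count P? (Vec.tabulate f) ≡ trues (List.tabulate (does ∘ P? ∘ f))
  count-tabulate {n = zero}  P? f = refl
  count-tabulate {n = suc n} P? f with does (P? (f zero))
  ... | true  = cong suc (count-tabulate P? (f ∘ suc))
  ... | false = count-tabulate P? (f ∘ suc)

  number-marks : ∀ {m} {P : Pred (Fin m) 0ℓ} (P? : Decidable P) → number P? ≡ trues (marks P?)
  number-marks P? = count-tabulate P? id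

  nonOverlapping-tail : ∀ {m} {P : Pred (Fin (suc m)) 0ℓ} (P? : Decidable P) {x I} →
    NonOverlapping P? (x ∷ I) → NonOverlapping (P? ∘ suc) I
  nonOverlapping-tail P? (sound , apart) =
    (λ i i∈I → sound (suc i) (there i∈I)) ,
    (λ i j i∈I j∈I i≢j → apart (suc i) (suc j) (there i∈I) (there j∈I) (i≢j ∘ Fin.suc-injective))

  -- A set omitting position 0 lives on the rest, whose packing is no larger. A set containing it
  -- must omit position 1, just as the greedy choice does.
  nonOverlapping-≤ : ∀ {m} {P : Pred (Fin m) 0ℓ} (P? : Decidable P) I →
    NonOverlapping P? I → ∣ I ∣ ≤ packing (marks P?)
  nonOverlapping-≤ P? []          _     = z≤n
  nonOverlapping-≤ P? (false ∷ I) valid = ≤-trans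
    (nonOverlapping-≤ (P? ∘ suc) I (nonOverlapping-tail P? valid))
    (packing-∷-≥ (does (P? zero)) (marks (P? ∘ suc)))
  nonOverlapping-≤ P? (true ∷ I) valid
    rewrite dec-true (P? zero) (proj₁ valid zero here) with I
  ... | []         = ≤-refl
  ... | true ∷ _   = contradiction (proj₂ valid zero (suc zero) here (there here) λ ()) λ { (s≤s ()) }
  ... | false ∷ I′ = s≤s (nonOverlapping-≤ (λ i → P? (suc (suc i))) I′
    (nonOverlapping-tail (P? ∘ suc) (nonOverlapping-tail P? valid)))

  nonOverlapping-skip : ∀ {m} {P : Pred (Fin (suc m)) 0ℓ} (P? : Decidable P) {I} →
    NonOverlapping (P? ∘ suc) I → NonOverlapping P? (false ∷ I)
  nonOverlapping-skip P? (sound , apart) =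
    (λ { (suc i) (there i∈I) → sound i i∈I }) ,
    (λ { (suc i) (suc j) (there i∈I) (there j∈I) i≢j → apart i j i∈I j∈I (i≢j ∘ cong suc) })

  nonOverlapping-take : ∀ {m} {P : Pred (Fin (suc (suc m))) 0ℓ} (P? : Decidable P) {I} → P zero →
    NonOverlapping (λ i → P? (suc (suc i))) I → NonOverlapping P? (true ∷ false ∷ I)
  nonOverlapping-take P? p₀ (sound , apart) =
    (λ { zero here → p₀ ; (suc (suc i)) (there (there i∈I)) → sound i i∈I }) ,
    λ { zero          zero          _                   _                   0≢0 → contradiction refl 0≢0
      ; zero          (suc zero)    _                   (there ())
      ; zero          (suc (suc j)) _                   _                   _   → s≤s (s≤s z≤n)
      ; (suc zero)    _             (there ())
      ; (suc (suc i)) zero          _                   _                   _   → s≤s (s≤s z≤n)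
      ; (suc (suc i)) (suc zero)    _                   (there ())
      ; (suc (suc i)) (suc (suc j)) (there (there i∈I)) (there (there j∈I)) i≢j →
          apart i j i∈I j∈I (i≢j ∘ cong (Fin.suc ∘ Fin.suc)) }

  nonOverlapping-∃ : ∀ {m} {P : Pred (Fin m) 0ℓ} (P? : Decidable P) →
    ∃ λ I → NonOverlapping P? I × ∣ I ∣ ≡ packing (marks P?)
  nonOverlapping-∃ {zero}        P? = [] , ((λ ()) , λ ()) , refl
  nonOverlapping-∃ {suc zero}    P? with P? zero
  ... | no _   = false ∷ [] , ((λ { zero () }) , λ { zero zero () }) , refl
  ... | yes p₀ = true ∷ [] , ((λ { zero _ → p₀ }) , λ { zero zero _ _ 0≢0 → contradiction refl 0≢0 }) , refl
  nonOverlapping-∃ {suc (suc m)} P?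
    with P? zero | nonOverlapping-∃ (P? ∘ suc) | nonOverlapping-∃ (λ i → P? (suc (suc i)))
  ... | no _   | I , valid , size | _ = false ∷ I , nonOverlapping-skip P? valid , size
  ... | yes p₀ | _ | I , valid , size = true ∷ false ∷ I , nonOverlapping-take P? p₀ valid , cong suc size

  maxNonOverlapping-marks : ∀ {m} {P : Pred (Fin m) 0ℓ} (P? : Decidable P) →
    maxNonOverlapping P? ≡ packing (marks P?)
  maxNonOverlapping-marks {m} P? with nonOverlapping-∃ P?
  ... | I , valid , size = max≈v⁺
    (subst (_∈ˡ List.map ∣_∣ candidates) size (∈-map⁺ ∣_∣
      (∈-filter⁺ (nonOverlapping? P?) (∈-allVecs (λ { true → here refl ; false → there (here refl) }) I) valid)))
    (All.map⁺ (All.map (λ {J} → nonOverlapping-≤ P? J) (All.all-filter (nonOverlapping? P?) subsets)))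
    z≤n
    where
    subsets candidates : List (Subset m)
    subsets    = allVecs (true ∷ false ∷ []) m
    candidates = List.filter (nonOverlapping? P?) subsets

  tabulate-constant : ∀ {m} {A : Set} {x : A} {f : Fin m → A} → (∀ i → f i ≡ x) →
    List.tabulate f ≡ replicate m x
  tabulate-constant {zero}  f≡x = refl
  tabulate-constant {suc m} f≡x = cong₂ _∷_ (f≡x zero) (tabulate-constant (f≡x ∘ suc))

  tabulate-exception : ∀ a {d} {A : Set} {x y : A} {f : Fin (a + suc d) → A} →
    (∀ i → toℕ i ≢ a → f i ≡ x) → (∀ i → toℕ i ≡ a → f i ≡ y) →
    List.tabulate f ≡ replicate a x ++ y ∷ replicate d x
  tabulate-exception zero    f≡x f≡y = cong₂ _∷_ (f≡y zero refl) (tabulate-constant λ i → f≡x (suc i) λ ())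
  tabulate-exception (suc a) f≡x f≡y = cong₂ _∷_ (f≡x zero λ ())
    (tabulate-exception a (λ i i≢a → f≡x (suc i) (i≢a ∘ suc-injective)) (λ i i≡a → f≡y (suc i) (cong suc i≡a)))

  trues-trues : ∀ d → trues (replicate d true) ≡ d
  trues-trues zero    = refl
  trues-trues (suc d) = cong suc (trues-trues d)

  trues-falses : ∀ d → trues (replicate d false) ≡ 0
  trues-falses zero    = refl
  trues-falses (suc d) = trues-falses d

  trues-true : ∀ a d → trues (replicate a false ++ true ∷ replicate d false) ≡ 1
  trues-true zero    d = cong suc (trues-falses d)
  trues-true (suc a) d = trues-true a d

  trues-false : ∀ a d → trues (replicate a true ++ false ∷ replicate d true) ≡ a + d
  trues-false zero    d = trues-trues d
  trues-false (suc a) d = cong suc (trues-false a d)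

  packing-trues : ∀ d → packing (replicate d true) ≡ ⌊ suc d /2⌋
  packing-trues zero          = refl
  packing-trues (suc zero)    = refl
  packing-trues (suc (suc d)) = cong suc (packing-trues d)

  packing-falses : ∀ d → packing (replicate d false) ≡ 0
  packing-falses zero    = refl
  packing-falses (suc d) = packing-falses d

  packing-true : ∀ a d → packing (replicate a false ++ true ∷ replicate d false) ≡ 1
  packing-true zero    zero    = refl
  packing-true zero    (suc d) = cong suc (packing-falses d)
  packing-true (suc a) d       = packing-true a d

  -- The `false` is paired with the last `true` before it if `a` is odd, and skipped if `a` is even;
  -- either way the greedy choice starts afresh on the second stretch.
  packing-false : ∀ a d → packing (replicate a true ++ false ∷ replicate d true) ≡ ⌊ suc a /2⌋ + ⌊ suc d /2⌋
  packing-false zero          d = packing-trues d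
  packing-false (suc zero)    d = cong suc (packing-trues d)
  packing-false (suc (suc a)) d = cong suc (packing-false a d)

  ascent-at : ∀ {m} (π : Word (suc m)) i → lookup π (inject₁ i) Fin.< lookup π (suc i) →
    does (ascent? π i) ≡ true × does (descent? π i) ≡ false
  ascent-at π@(_ ∷ _) i lt = dec-true (ascent? π i) lt , dec-false (descent? π i) (<-asym lt)

  descent-at : ∀ {m} (π : Word (suc m)) i → lookup π (suc i) Fin.< lookup π (inject₁ i) →
    does (ascent? π i) ≡ false × does (descent? π i) ≡ true
  descent-at π@(_ ∷ _) i gt = dec-false (ascent? π i) (<-asym gt) , dec-true (descent? π i) gt

  module _ {m a b} .(a+b≤n : a + b ≤ suc m) where
    private
      π : Word (suc m)
      π = rotatedWord a b a+b≤n

      here-letter : (i : Fin m) → rotated a b (toℕ i) ≡ toℕ (lookup π (inject₁ i))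
      here-letter i = trans (cong (rotated a b) (sym (toℕ-inject₁ i))) (sym (lookup-rotatedWord a b a+b≤n (inject₁ i)))

      next-letter : (i : Fin m) → rotated a b (suc (toℕ i)) ≡ toℕ (lookup π (suc i))
      next-letter i = sym (lookup-rotatedWord a b a+b≤n (suc i))

    rotatedWord-ascent : ∀ i → ¬ Inversion a b (toℕ i) (suc (toℕ i)) →
      does (ascent? π i) ≡ true × does (descent? π i) ≡ false
    rotatedWord-ascent i ¬inv with rotated-compare a b (n<1+n (toℕ i))
    ... | inj₁ lt        = ascent-at π i (subst₂ _<_ (here-letter i) (next-letter i) lt)
    ... | inj₂ (inv , _) = contradiction inv ¬inv

    rotatedWord-descent : ∀ i → Inversion a b (toℕ i) (suc (toℕ i)) →
      does (ascent? π i) ≡ false × does (descent? π i) ≡ true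
    rotatedWord-descent i inv = descent-at π i
      (subst₂ _<_ (next-letter i) (here-letter i) (inversion-rotated a b inv))

  Statistics : ∀ {n} → Word n → (asc′ des′ mna mnd : ℕ) → Set
  Statistics π asc′ des′ mna mnd = asc π ≡ asc′ × des π ≡ des′ × MNA π ≡ mna × MND π ≡ mnd

  statistics-marks : ∀ {n} (π : Word n) {as ds} → marks (ascent? π) ≡ as → marks (descent? π) ≡ ds →
    ∀ {asc′ des′ mna mnd} → trues as ≡ asc′ → trues ds ≡ des′ → packing as ≡ mna → packing ds ≡ mnd →
    Statistics π asc′ des′ mna mnd
  statistics-marks π refl refl refl refl refl refl =
    number-marks (ascent? π) , number-marks (descent? π) ,
    maxNonOverlapping-marks (ascent? π) , maxNonOverlapping-marks (descent? π)

  identity-statistics : ∀ m → Statistics (rotatedWord {suc m} 0 0 z≤n) m 0 ⌊ suc m /2⌋ 0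
  identity-statistics m = statistics-marks _
    (tabulate-constant (λ i → proj₁ (ascent i))) (tabulate-constant (λ i → proj₂ (ascent i)))
    (trues-trues m) (trues-falses m) (packing-trues m) (packing-falses m)
    where
    ascent = λ i → rotatedWord-ascent {m} {0} {0} z≤n i λ ()

  -- For the neighbours i and i + 1 to be an inversion, i must be the last position of the left
  -- block. So the only descent is at `a`, whatever `b` is, and the remaining marks split into `a`
  -- and `d` ascents.
  rotation-statistics : ∀ {n} a d {b} → suc a + suc d ≡ n → .(le : suc a + suc b ≤ n) →
    Statistics (rotatedWord (suc a) (suc b) le) (a + d) 1 (⌊ suc a /2⌋ + ⌊ suc d /2⌋) 1
  rotation-statistics a d {b} refl le = statistics-marks _
    (tabulate-exception a (λ i i≢a → proj₁ (ascent i i≢a)) (λ i i≡a → proj₁ (descent i i≡a)))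
    (tabulate-exception a (λ i i≢a → proj₂ (ascent i i≢a)) (λ i i≡a → proj₂ (descent i i≡a)))
    (trues-false a d) (trues-true a d) (packing-false a d) (packing-true a d)
    where
    ascent = λ i i≢a → rotatedWord-ascent {a + suc d} {suc a} {suc b} le i λ
      { (s≤s i≤a , s≤s a≤i , _) → i≢a (≤-antisym i≤a a≤i) }
    descent = λ i i≡a → rotatedWord-descent {a + suc d} {suc a} {suc b} le i
      (subst (λ i → Inversion (suc a) (suc b) i (suc i)) (sym i≡a)
        (≤-refl , ≤-refl , s≤s (m<m+n a (s≤s z≤n))))

-- Total weight of the avoiders of each length.

module WeightSum (R : CommutativeRing 0ℓ 0ℓ) (p q y z : CommutativeRing.Carrier R) where
  open Avoiders
  private module R = CommutativeRing R
  open R using (_≈_; _+_; _*_; 0#; 1#; +-cong; +-congˡ; *-congˡ; *-congʳ; setoid)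
  open RawSemiringDefinitions (RawRing.rawSemiring R.rawRing) using (_^_; _×_; sum)
  open import Algebra.Properties.Semiring.Exp R.semiring using (^-homo-*)
  open import Algebra.Properties.Semiring.Mult R.semiring using (×-comm-*)
  open import Algebra.Properties.Semiring.Sum R.semiring using (*-distribˡ-sum; sum-cong-≋)
  open GeneratingFunction R p q y z using (run; weightedRun)
  open Solver R.commutativeSemiring using (solve; con; _:+_; _:*_; _:=_)
  open ≈-Reasoning setoid

  coefficientNotation : CoefficientNotation R.Carrier
  coefficientNotation = record
    { _+_ = _+_ ; _*_ = _*_ ; 0# = 0# ; _^_ = _^_ ; p = p ; q = q ; y = y ; z = z }

  open CoefficientNotation coefficientNotation using (weight; total)

  total-↭ : ∀ {n} {πs ρs : List (Word n)} → πs ↭ ρs → total πs ≈ total ρs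
  total-↭ ↭.refl          = R.refl
  total-↭ (↭.prep π ↭)    = +-congˡ (total-↭ ↭)
  total-↭ (↭.swap π ρ ↭)  = R.trans
    (solve 3 (λ a b c → a :+ (b :+ c) := b :+ (a :+ c)) R.refl (weight π) (weight ρ) _)
    (+-congˡ (+-congˡ (total-↭ ↭)))
  total-↭ (↭.trans ↭₁ ↭₂) = R.trans (total-↭ ↭₁) (total-↭ ↭₂)

  total-++ : ∀ {n} (πs ρs : List (Word n)) → total (πs ++ ρs) ≈ total πs + total ρs
  total-++ []       ρs = R.sym (R.+-identityˡ (total ρs))
  total-++ (π ∷ πs) ρs = R.trans (+-congˡ (total-++ πs ρs)) (R.sym (R.+-assoc (weight π) (total πs) (total ρs)))

  total-concat : ∀ {n k} (πss : Fin k → List (Word n)) → total (concat (List.tabulate πss)) ≈ sum (total ∘ πss)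
  total-concat {k = zero}  πss = R.refl
  total-concat {k = suc k} πss =
    R.trans (total-++ (πss zero) _) (+-congˡ (total-concat (πss ∘ suc)))

  total-tabulate : ∀ {n k c} (πs : Fin k → Word n) → (∀ i → weight (πs i) ≈ c) → total (List.tabulate πs) ≈ k × c
  total-tabulate {k = zero}  πs ≈c = R.refl
  total-tabulate {k = suc k} πs ≈c = +-cong (≈c zero) (total-tabulate (πs ∘ suc) (≈c ∘ suc))

  weight-≈ : ∀ {n} (π : Word n) {asc′ des′ mna mnd} → Statistics π asc′ des′ mna mnd →
    weight π ≈ p ^ asc′ * q ^ des′ * y ^ mna * z ^ mnd
  weight-≈ π (≡.refl , ≡.refl , ≡.refl , ≡.refl) = R.refl

  weight-identity : ∀ m → weight (rotatedWord {suc m} 0 0 z≤n) ≈ run (suc m)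
  weight-identity m = R.trans (weight-≈ (rotatedWord {suc m} 0 0 z≤n) (identity-statistics m))
    (solve 2 (λ a b → a :* con 1 :* b :* con 1 := a :* b) R.refl (p ^ m) (y ^ ⌊ suc m /2⌋))

  weight-rotation : ∀ {n} a d {b} → suc a ℕ.+ suc d ≡ n → .(le : suc a ℕ.+ suc b ≤ n) →
    weight (rotatedWord (suc a) (suc b) le) ≈ q * (z * (run (suc a) * run (suc d)))
  weight-rotation {n} a d {b} eq le = begin
    weight (rotatedWord (suc a) (suc b) le)
      ≈⟨ weight-≈ (rotatedWord (suc a) (suc b) le) (rotation-statistics a d {b} eq le) ⟩
    p ^ (a ℕ.+ d) * q ^ 1 * y ^ (⌊ suc a /2⌋ ℕ.+ ⌊ suc d /2⌋) * z ^ 1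
      ≈⟨ *-congʳ (R.*-cong (*-congʳ (^-homo-* p a d)) (^-homo-* y ⌊ suc a /2⌋ ⌊ suc d /2⌋)) ⟩
    p ^ a * p ^ d * q ^ 1 * (y ^ ⌊ suc a /2⌋ * y ^ ⌊ suc d /2⌋) * z ^ 1
      ≈⟨ solve 6 (λ a b q c d z → a :* b :* (q :* con 1) :* (c :* d) :* (z :* con 1) :=
           q :* (z :* ((a :* c) :* (b :* d)))) R.refl (p ^ a) (p ^ d) q (y ^ ⌊ suc a /2⌋) (y ^ ⌊ suc d /2⌋) z ⟩
    q * (z * (run (suc a) * run (suc d))) ∎

  -- The summands have a common weight; their number `d` is moved onto the second run, where it
  -- turns `run d` into `weightedRun d`.
  total-rotationsFrom : ∀ {m} (i : Fin (suc m)) →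
    total (rotationsFrom (suc m) i) ≈ q * (z * (run (suc (toℕ i)) * weightedRun (m ∸ toℕ i)))
  total-rotationsFrom {m} i = begin
    total (rotationsFrom (suc m) i)
      ≈⟨ total-tabulate {suc m} {d} (λ b → rotatedWord (suc a) (suc (toℕ b)) (block-sizes (suc m) i b))
           (λ b → weights d ≡.refl b (block-sizes (suc m) i b)) ⟩
    d × (q * (z * (run (suc a) * run d)))
      ≈⟨ ×-comm-* d q _ ⟨
    q * (d × (z * (run (suc a) * run d)))
      ≈⟨ *-congˡ (×-comm-* d z _) ⟨
    q * (z * (d × (run (suc a) * run d)))
      ≈⟨ *-congˡ (*-congˡ (×-comm-* d (run (suc a)) (run d))) ⟨
    q * (z * (run (suc a) * weightedRun d)) ∎
    where
    a = toℕ i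
    d = m ∸ a

    -- Abstracting `m ∸ a` to a variable allows matching it as a successor, as `weight-rotation`
    -- requires; for zero there is no index `b`.
    weights : ∀ d → m ∸ a ≡ d → (b : Fin d) → .(le : suc a ℕ.+ suc (toℕ b) ≤ suc m) →
      weight {suc m} (rotatedWord (suc a) (suc (toℕ b)) le) ≈ q * (z * (run (suc a) * run d))
    weights (suc d′) eq b le = weight-rotation a d′
      (≡.cong suc (≡.trans (≡.cong (a ℕ.+_) (≡.sym eq)) (m+[n∸m]≡n (s≤s⁻¹ (toℕ<n i))))) le

  total-avoiders : ∀ m → total (avoiders (suc m)) ≈
    run (suc m) + q * (z * sum {suc m} λ i → run (suc (toℕ i)) * weightedRun (m ∸ toℕ i))
  total-avoiders m = +-cong (weight-identity m) (begin
    total (concat (List.tabulate (rotationsFrom (suc m))))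
      ≈⟨ total-concat (rotationsFrom (suc m)) ⟩
    sum (total ∘ rotationsFrom (suc m))
      ≈⟨ sum-cong-≋ (total-rotationsFrom {m}) ⟩
    sum (λ i → q * (z * term i))
      ≈⟨ *-distribˡ-sum q (λ i → z * term i) ⟨
    q * sum (λ i → z * term i)
      ≈⟨ *-congˡ (*-distribˡ-sum z term) ⟨
    q * (z * sum term) ∎)
    where
    term : Fin (suc m) → R.Carrier
    term i = run (suc (toℕ i)) * weightedRun (m ∸ toℕ i)

  total-S-zero : total (S 0 [132] [321]) ≈ 1#
  total-S-zero = R.trans (total-↭ (S↭avoiders 0))
    (solve 0 (con 1 :* con 1 :* con 1 :* con 1 :+ con 0 := con 1) R.refl)

  total-S-suc : ∀ m → total (S (suc m) [132] [321]) ≈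
    run (suc m) + q * (z * sum {suc m} λ i → run (suc (toℕ i)) * weightedRun (m ∸ toℕ i))
  total-S-suc m = R.trans (total-↭ (S↭avoiders (suc m))) (total-avoiders m)

-- The rational form over any coefficient ring, and its instance.

module _ (R : CommutativeRing 0ℓ 0ℓ) (p₀ q₀ y₀ z₀ : CommutativeRing.Carrier R) where
  private module R = CommutativeRing R
  open GeneratingFunction R p₀ q₀ y₀ z₀ using (X; ⟨_⟩; denominator-inverse; generating-function)
  open Numerator (powerSeriesRing R) using (seriesNotation)
  open WeightSum R p₀ q₀ y₀ z₀ using (coefficientNotation; total-S-zero; total-S-suc)

  -- The notations, `f` and `A` enter through equations, so the proof runs over the abstract ring
  -- and a concrete instance only has to supply `refl`.
  rational-generating-function :
    ∀ {C : CoefficientNotation R.Carrier} → C ≡ coefficientNotation →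
    ∀ {N : SeriesNotation (ℕ → R.Carrier)} → N ≡ seriesNotation X ⟨ p₀ ⟩ ⟨ q₀ ⟩ ⟨ y₀ ⟩ ⟨ z₀ ⟩ →
    ∀ f → (∀ n → f n ≡ CoefficientNotation.total C (S n [132] [321])) →
    ∀ A → A ≡ SeriesNotation.numerator N → SeriesNotation.IsRational N f A
  rational-generating-function ≡.refl ≡.refl f f≡ _ ≡.refl =
    denominator-inverse , generating-function f
      (coefficient 0 total-S-zero) (λ m → coefficient (suc m) (total-S-suc m))
    where
    coefficient : ∀ n {c} → _ R.≈ c → f n R.≈ c
    coefficient n = R.trans (R.reflexive (f≡ n))

theorem4 : let open Series in
    Σ (Invertible _≈_ 1# _*_ ((1# - p ^ 2 * x ^ 2 * y) ^ 3))
    (λ (D⁻¹ , _) → G [132] [321] ≈ A * D⁻¹)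
-- Agda inlines the operators of Coefficients and Series in terms but not in type signatures.
-- Without the η-expansions and the signature of N≡, the terms to be compared would not be
-- syntactically equal, and unfolding them takes minutes.
theorem4 = rational-generating-function coefficientRing p q y z
  {record
    { _+_ = λ a b → a + b ; _*_ = λ a b → a * b ; 0# = 0# ; _^_ = λ a n → a ^ n
    ; p = p ; q = q ; y = y ; z = z
    }} ≡.refl
  N≡ (G [132] [321]) (λ n → ≡.refl) Series.A ≡.refl
  where
  open Coefficients using (_+_; _*_; 0#; _^_; p; q; y; z)

  coefficientRing : CommutativeRing 0ℓ 0ℓ
  coefficientRing = powerSeriesRing (powerSeriesRing (powerSeriesRing (powerSeriesRing +-*-commutativeRing)))

  open GeneratingFunction coefficientRing p q y z using (X; ⟨_⟩)

  N≡ : record { Series } ≡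
    Numerator.seriesNotation (powerSeriesRing coefficientRing) X ⟨ p ⟩ ⟨ q ⟩ ⟨ y ⟩ ⟨ z ⟩
  N≡ = ≡.refl
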